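{- For every integer $i\ge 1$, $J(3i+1,\,2i)$ is positive and equals $\frac{3}{2}\binom{2i}{i}$.
   Context: Let $\pi=\pi_1\cdots\pi_n$ be a permutation of $[n]$. An entry $\pi_i$ is a left-to-right minimum if $\pi_j>\pi_i$ for all $j<i$. Let the left-to-right minima of $\pi$ be at positions $k_1<k_2<\dots<k_a$ (so $\pi_{k_1}>\dots>\pi_{k_a}$), and set $\pi_{k_0}:=n+1$ and $k_{a+1}:=n+1$. The staircase grid $B_a$ consists of the boxes $(i,j)$ with $1\le i\le j\le a$, where $i$ is the row index counted from the top and $j$ is the column index counted from the left. The staircase encoding of $\pi$ fills box $(i,j)$ of $B_a$ with the number of indices $p$ with $k_j<p<k_{j+1}$ and $\pi_{k_i}<\pi_p<\pi_{k_{i-1}}$. A permutation $\pi$ contains $132$ if there are indices $p<q<r$ with $\pi_p<\pi_r<\pi_q$, and avoids $132$ otherwise. For integers $\ell\ge1$, $k\ge0$, let $J(\ell,k)$ denote the number of $132$-avoiding permutations of $[\ell]$ whose staircase encoding has exactly $k$ nonzero boxes. -}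

module Defs where

open import Data.Bool using (Bool; true; false; _∧_; not; if_then_else_)
open import Data.Nat using (ℕ; zero; suc; _<_; _∸_; _≤ᵇ_; _<ᵇ_; _≡ᵇ_)
open import Data.List using (List; []; _∷_; length; upTo; map; filterᵇ; concatMap)
open import Data.Bool.ListAction using (and)
open import Data.List.Membership.Propositional using (_∈_)
open import Data.List.Relation.Unary.Unique.Propositional using (Unique)
open import Data.List.Relation.Binary.Permutation.Propositional using (_↭_)
open import Data.Product using (_×_; Σ)
open import Relation.Binary.PropositionalEquality using (_≡_)
open import Relation.Nullary using (¬_)
open import Function.Bundles using (_⇔_)

-- A permutation of [n] = {1,…,n} is written in one-line notation as a list
-- π = π₁ ⋯ πₙ.  Positions are 0-based in the code: position p holds π_{p+1}.

-- entry at (0-based) position p; default 0 out of range (never used in range)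
at : List ℕ → ℕ → ℕ
at []       _       = 0
at (x ∷ xs) zero    = x
at (x ∷ xs) (suc p) = at xs p

IsPerm : ℕ → List ℕ → Set
IsPerm n π = π ↭ map suc (upTo n)

Contains132 : List ℕ → Set
Contains132 π = Σ ℕ λ p → Σ ℕ λ q → Σ ℕ λ r →
  p < q × q < r × r < length π × at π p < at π r × at π r < at π q

Avoids132 : List ℕ → Set
Avoids132 π = ¬ Contains132 π

lrMinPositions : List ℕ → List ℕ
lrMinPositions π =
  filterᵇ (λ i → and (map (λ j → at π i <ᵇ at π j) (upTo i))) (upTo (length π))

numLRMin : List ℕ → ℕ
numLRMin π = length (lrMinPositions π)

-- k_j for 1 ≤ j ≤ a+1 (0-based positions); k_{a+1} := n (the 0-based
-- counterpart of the paper's n+1).  k_0 is never used.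
kpos : List ℕ → ℕ → ℕ
kpos π zero    = 0
kpos π (suc j) = if j <ᵇ numLRMin π then at (lrMinPositions π) j else length π

kval : List ℕ → ℕ → ℕ
kval π zero    = suc (length π)
kval π (suc i) = at π (kpos π (suc i))

-- content of box (i,j) of the staircase encoding (1 ≤ i ≤ j ≤ a):
-- #{p : k_j < p < k_{j+1}, π_{k_i} < π_p < π_{k_{i-1}}}
box : List ℕ → ℕ → ℕ → ℕ
box π i j = length (filterᵇ
  (λ p → (kpos π j <ᵇ p) ∧ (p <ᵇ kpos π (suc j))
       ∧ (kval π i <ᵇ at π p) ∧ (at π p <ᵇ kval π (i ∸ 1)))
  (upTo (length π)))

boxesOf : ℕ → List (Σ ℕ λ _ → ℕ)
boxesOf a = concatMap (λ i → concatMap (λ j →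
    if suc i ≤ᵇ suc j then ((suc i Data.Product., suc j) ∷ []) else [])
  (upTo a)) (upTo a)

nonzeroBoxes : List ℕ → ℕ
nonzeroBoxes π = length (filterᵇ
  (λ b → not (box π (Data.Product.proj₁ b) (Data.Product.proj₂ b) ≡ᵇ 0))
  (boxesOf (numLRMin π)))

JProp : ℕ → ℕ → List ℕ → Set
JProp ℓ k π = IsPerm ℓ π × Avoids132 π × nonzeroBoxes π ≡ k

HasCount : (List ℕ → Set) → ℕ → Set
HasCount P m = Σ (List (List ℕ)) λ L →
  Unique L × (∀ π → (π ∈ L) ⇔ P π) × length L ≡ m

JIs : ℕ → ℕ → ℕ → Set
JIs ℓ k m = HasCount (JProp ℓ k) m

{-# OPTIONS --safe #-}

-- Write a 132-avoider as σ n τ with n its maximum; then σ lies above τ, so avoiders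
-- are binary trees. For σ nonempty, the boxes of σ n τ are those of σ, those of τ
-- shifted diagonally, and the box (1, a) of n itself, where a is the number of minima
-- of σ; that box is already occupied by σ exactly when σ ends in its maximum and is
-- not a single entry. With n entries and k nonzero boxes, the excess 2n − 3k − 1 is
-- nonnegative and nearly additive along this decomposition, and (n, k) = (3i+1, 2i)
-- has excess 1. The trees of excess 1 are those of a Catalan family with generating
-- function C = 1 + zC², and those of a family with generating function
-- M = zC + zC² + 2zCM. Counting forests instead of single trees turns these
-- equations into two-index recurrences, solved by Pascal's rule.
module Submission where

open import Defs
open import Data.Bool using (Bool; true; false; if_then_else_; _∧_; not; T; T?)
open import Data.Bool.ListAction using (and)
open import Data.Bool.Properties using (T-≡; T-∧; ¬-not; ∧-identityʳ; ∧-zeroʳ)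
open import Data.Empty using (⊥; ⊥-elim)
open import Data.List using (List; []; _∷_; _++_; _∷ʳ_; map; length; upTo; applyUpTo; filterᵇ; concatMap)
open import Data.List.Membership.Propositional using (_∈_)
open import Data.List.Membership.Propositional.Properties
open import Data.List.Membership.Propositional.Properties.WithK using (unique∧set⇒bag)
open import Data.List.Properties
  using (length-++; length-map; length-filter; filter-none; length-applyUpTo; applyUpTo-∷ʳ;
         map-upTo; ∷-injective; ++-identityʳ)
open import Data.List.Relation.Binary.BagAndSetEquality using (∼bag⇒↭)
open import Data.List.Relation.Binary.Permutation.Propositional as Perm
  using (_↭_; ↭-sym; ↭-trans; ↭-reflexive; ↭⇒↭ₛ)
import Data.List.Relation.Binary.Permutation.Propositional.Properties as Permₚ
import Data.List.Relation.Binary.Permutation.Setoid.Properties as PermSetoidₚ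
open import Data.List.Relation.Binary.Pointwise using (Pointwise-≡⇒≡)
open import Data.List.Relation.Unary.All as All using (All; []; _∷_)
import Data.List.Relation.Unary.All.Properties as Allₚ
open import Data.List.Relation.Unary.AllPairs as AllPairs using (AllPairs; []; _∷_)
import Data.List.Relation.Unary.AllPairs.Properties as AllPairsₚ
open import Data.List.Relation.Unary.Any using (here; there)
open import Data.List.Relation.Unary.Sorted.TotalOrder.Properties
  using (AllPairs⇒Sorted; Sorted⇒AllPairs; ↗↭↗⇒≋)
open import Data.List.Relation.Unary.Unique.Propositional using (Unique)
import Data.List.Relation.Unary.Unique.Propositional.Properties as Uniqueₚ
open import Data.Nat
open import Data.Nat.Combinatorics using (_C_; nCk+nC[k+1]≡[n+1]C[k+1]; nCk≡nC[n∸k]; nCn≡1)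
open import Data.Nat.Properties
open import Data.List.Sort ≤-decTotalOrder using (sort; sort-↭; sort-↗)
open import Data.Nat.Tactic.RingSolver using (solve-∀)
open import Data.Product using (Σ; ∃; _×_; _,_; proj₁; proj₂)
open import Data.Sum using (_⊎_; inj₁; inj₂; [_,_]′)
open import Data.Vec as Vec using (Vec; []; _∷_)
open import Function using (_∘_; id; _⇔_; mk⇔)
open import Function.Bundles using (Equivalence)
open import Relation.Binary.PropositionalEquality
open import Relation.Nullary using (¬_; yes; no)
open Equivalence using (to; from)

-- Finite counting

-- A tree without corner has excess at least 1. If σ has no corner and excess 1 + d, and τ is
-- nonempty of excess e, then σ n τ has no corner and excess 1 + (d + e); the other ways of gluing
-- raise the excess by 2 or 3, or append a maximum that lowers it by 1. So a total of 0 or 1 can be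
-- distributed in a handful of ways only, and these ways are the constructors of the two families. A
-- tree of excess 1 is either a Catalan tree or a maximum appended to a tree without corner of
-- excess 2. Forests avoid convolutions: opening the first tree merely replaces it by its subtrees,
-- so a product of series becomes a longer list. The factor 3/2 arises as follows. The Catalan trees
-- number binom(2i, i) - binom(2i, i-1), the others number binom(2i, i)/2 + binom(2i, i-1), and the
-- off-centre terms cancel.

Counted : {A : Set} → (A → Set) → ℕ → Set
Counted {A} P m = Σ (List A) λ L →
  Unique L × (∀ x → (x ∈ L) ⇔ P x) × length L ≡ m

module _ {A : Set} {P : A → Set} where

  counted-⇔ : ∀ {Q : A → Set} {m} → (∀ x → P x → Q x) → (∀ x → Q x → P x) →
              Counted P m → Counted Q m
  counted-⇔ f g (L , u , e , l) =
    L , u , (λ x → mk⇔ (f x ∘ to (e x)) (from (e x) ∘ g x)) , l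

  counted-⊥ : (∀ x → ¬ P x) → Counted P 0
  counted-⊥ ¬P = [] , [] , (λ x → mk⇔ (λ ()) (⊥-elim ∘ ¬P x)) , refl

  counted-singleton : (x : A) → P x → (∀ y → P y → y ≡ x) → Counted P 1
  counted-singleton x Px uniq = x ∷ [] , [] ∷ [] ,
    (λ y → mk⇔ (λ { (here refl) → Px }) (λ Py → here (uniq y Py))) , refl

  counted-⊎ : ∀ {Q : A → Set} {m n} → (∀ x → P x → ¬ Q x) →
              Counted P m → Counted Q n → Counted (λ x → P x ⊎ Q x) (m + n)
  counted-⊎ disj (L , u , e , l) (L′ , u′ , e′ , l′) =
    L ++ L′ ,
    Uniqueₚ.++⁺ u u′ (λ (p , q) → disj _ (to (e _) p) (to (e′ _) q)) ,
    (λ x → mk⇔ ([ inj₁ ∘ to (e x) , inj₂ ∘ to (e′ x) ]′ ∘ ∈-++⁻ L)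
               [ ∈-++⁺ˡ ∘ from (e x) , ∈-++⁺ʳ L ∘ from (e′ x) ]′) ,
    trans (length-++ L) (cong₂ _+_ l l′)

  counted-map : ∀ {B : Set} {m} (f : A → B) →
                (∀ {x y} → f x ≡ f y → x ≡ y) →
                Counted P m → Counted (λ y → ∃ λ x → P x × y ≡ f x) m
  counted-map f inj (L , u , e , l) =
    map f L , Uniqueₚ.map⁺ inj u ,
    (λ y → mk⇔ (λ y∈ → let (x , x∈ , eq) = ∈-map⁻ f y∈ in x , to (e x) x∈ , eq)
               (λ { (x , Px , refl) → ∈-map⁺ f (from (e x) Px) })) ,
    trans (length-map f L) l

-- Trees, and forests of the two families

-- A tree encodes a 132-avoider split at its maximum: node l r is σ max τ, with σ
-- given by l, τ given by r, and every entry of σ above every entry of τ.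
data Tree : Set where
  leaf : Tree
  node : Tree → Tree → Tree

-- NForest: trees without corner of excess 1. MForest: one tree without corner of
-- excess 2, followed by trees as in NForest (corner and Excess are defined below).
-- Reading node a (node b leaf) as a binary node with children a and b, an NForest of
-- grade n is a forest of binary trees with n internal nodes in total.
data NForest : ∀ {r} → ℕ → Vec Tree r → Set where
  []     : NForest 0 []
  single : ∀ {r n} {ts : Vec Tree r} → NForest n ts → NForest n (node leaf leaf ∷ ts)
  both   : ∀ {r n a b} {ts : Vec Tree r} → NForest n (a ∷ b ∷ ts) →
           NForest (suc n) (node a (node b leaf) ∷ ts)

data MForest : ∀ {r} → ℕ → Vec Tree r → Set where
  right : ∀ {r n a} {ts : Vec Tree r} → NForest n (a ∷ ts) →
          MForest (suc n) (node leaf (node a leaf) ∷ ts)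
  nn    : ∀ {r n a b} {ts : Vec Tree r} → NForest n (a ∷ b ∷ ts) →
          MForest (suc n) (node a b ∷ ts)
  nm    : ∀ {r n m a} {ts : Vec Tree r} → MForest n (m ∷ a ∷ ts) →
          MForest (suc n) (node a (node m leaf) ∷ ts)
  mn    : ∀ {r n m a} {ts : Vec Tree r} → MForest n (m ∷ a ∷ ts) →
          MForest (suc n) (node m (node a leaf) ∷ ts)

-- The coefficient of z^n in C^r, from C^r = C^(r-1) + z C^(r+1): the first tree is a single node or
-- is opened into two.
#N : ℕ → ℕ → ℕ
#N zero    zero    = 1
#N zero    (suc n) = 0
#N (suc r) zero    = #N r zero
#N (suc r) (suc n) = #N r (suc n) + #N (2 + r) n

-- The coefficient of z^n in M C^r, from M C^r = z C^(r+1) + z C^(r+2) + 2z M C^(r+1). The repeated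
-- summand stands for `nm` and `mn`.
#M : ℕ → ℕ → ℕ
#M r zero    = 0
#M r (suc n) = #N (suc r) n + (#N (2 + r) n + (#M (suc r) n + #M (suc r) n))

graft₁ : (Tree → Tree) → ∀ {r} → Vec Tree (suc r) → Vec Tree (suc r)
graft₁ g (a ∷ ts) = g a ∷ ts

graft₂ : (Tree → Tree → Tree) → ∀ {r} → Vec Tree (2 + r) → Vec Tree (suc r)
graft₂ g (a ∷ b ∷ ts) = g a b ∷ ts

-- The recursion is lexicographic in (n, r): opening a tree lengthens the forest but lowers the
-- grade.
counted-NForest : ∀ r n → Counted (NForest {r} n) (#N r n)
counted-NForest zero zero = counted-singleton [] [] (λ { [] [] → refl })
counted-NForest zero (suc n) = counted-⊥ (λ { _ () })
counted-NForest (suc r) zero =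
  counted-⇔ (λ { _ (_ , p , refl) → single p }) (λ { _ (single p) → _ , p , refl })
    (counted-map (node leaf leaf ∷_) (λ { refl → refl }) (counted-NForest r zero))
counted-NForest (suc r) (suc n) =
  counted-⇔
    (λ { _ (inj₁ (_ , p , refl)) → single p
       ; _ (inj₂ (_ ∷ _ ∷ _ , p , refl)) → both p })
    (λ { _ (single p) → inj₁ (_ , p , refl)
       ; _ (both p) → inj₂ (_ , p , refl) })
    (counted-⊎ (λ { _ (_ , _ , refl) (_ ∷ _ ∷ _ , _ , ()) })
      (counted-map (node leaf leaf ∷_) (λ { refl → refl }) (counted-NForest r (suc n)))
      (counted-map (graft₂ λ a b → node a (node b leaf)) (λ { {_ ∷ _ ∷ _} {_ ∷ _ ∷ _} refl → refl })
        (counted-NForest (2 + r) n)))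

-- `N` and `M` forget the grade: the excess determines the shape of a tree, and its grade is read
-- off from the size afterwards.
data N : Tree → Set where
  single : N (node leaf leaf)
  both   : ∀ {a b} → N a → N b → N (node a (node b leaf))

data M : Tree → Set where
  right : ∀ {a} → N a → M (node leaf (node a leaf))
  nn    : ∀ {a b} → N a → N b → M (node a b)
  nm    : ∀ {m a} → M m → N a → M (node a (node m leaf))
  mn    : ∀ {m a} → M m → N a → M (node m (node a leaf))

head-N : ∀ {r n a} {ts : Vec Tree r} → NForest n (a ∷ ts) → N a × (∃ λ k → NForest k ts)
head-N (single p) = single , _ , p
head-N (both p) = let (na , _ , q) = head-N p; (nb , k , q′) = head-N q in both na nb , k , q′

head-M : ∀ {r n a} {ts : Vec Tree r} → MForest n (a ∷ ts) → M a × (∃ λ k → NForest k ts)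
head-M (right p) = let (na , k , q) = head-N p in right na , k , q
head-M (nn p) = let (na , _ , q) = head-N p; (nb , k , q′) = head-N q in nn na nb , k , q′
head-M (nm p) = let (mm , _ , q) = head-M p; (na , k , q′) = head-N q in nm mm na , k , q′
head-M (mn p) = let (mm , _ , q) = head-M p; (na , k , q′) = head-N q in mn mm na , k , q′

-- An overlap of `both` with `nm` or `mn` contains a smaller overlap in a subtree.
N-M-disjoint : ∀ {t} → N t → ¬ M t
N-M-disjoint single (nn () _)
N-M-disjoint (both () _) (right _)
N-M-disjoint (both _ ()) (nn _ single)
N-M-disjoint (both na nb) (nm mm _) = N-M-disjoint nb mm
N-M-disjoint (both na nb) (mn mm _) = N-M-disjoint na mm

N-node-leaf : ∀ {a} → N (node a leaf) → a ≡ leaf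
N-node-leaf single = refl

¬N-leaf : ¬ N leaf
¬N-leaf ()

¬M-leaf : ¬ M leaf
¬M-leaf ()

counted-MForest : ∀ r n → Counted (MForest {suc r} n) (#M r n)
counted-MForest r zero = counted-⊥ (λ { _ () })
counted-MForest r (suc n) =
  counted-⇔
    (λ { _ (inj₁ (_ ∷ _ , p , refl)) → right p
       ; _ (inj₂ (inj₁ (_ ∷ _ ∷ _ , p , refl))) → nn p
       ; _ (inj₂ (inj₂ (inj₁ (_ ∷ _ ∷ _ , p , refl)))) → nm p
       ; _ (inj₂ (inj₂ (inj₂ (_ ∷ _ ∷ _ , p , refl)))) → mn p })
    (λ { _ (right p) → inj₁ (_ , p , refl)
       ; _ (nn p) → inj₂ (inj₁ (_ , p , refl))
       ; _ (nm p) → inj₂ (inj₂ (inj₁ (_ , p , refl)))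
       ; _ (mn p) → inj₂ (inj₂ (inj₂ (_ , p , refl))) })
    (counted-⊎ right-disjoint
      (counted-map (graft₁ λ a → node leaf (node a leaf)) (λ { {_ ∷ _} {_ ∷ _} refl → refl })
        (counted-NForest (suc r) n))
      (counted-⊎ nn-disjoint
        (counted-map (graft₂ node) (λ { {_ ∷ _ ∷ _} {_ ∷ _ ∷ _} refl → refl })
          (counted-NForest (2 + r) n))
        (counted-⊎ nm-mn-disjoint
          (counted-map (graft₂ λ m a → node a (node m leaf))
            (λ { {_ ∷ _ ∷ _} {_ ∷ _ ∷ _} refl → refl }) (counted-MForest (suc r) n))
          (counted-map (graft₂ λ m a → node m (node a leaf))
            (λ { {_ ∷ _ ∷ _} {_ ∷ _ ∷ _} refl → refl }) (counted-MForest (suc r) n)))))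
  where
  Right NN NM MN : Vec Tree (suc r) → Set
  Right ts = ∃ λ us → NForest n us × ts ≡ graft₁ (λ a → node leaf (node a leaf)) us
  NN ts = ∃ λ us → NForest n us × ts ≡ graft₂ node us
  NM ts = ∃ λ us → MForest n us × ts ≡ graft₂ (λ m a → node a (node m leaf)) us
  MN ts = ∃ λ us → MForest n us × ts ≡ graft₂ (λ m a → node m (node a leaf)) us

  right-disjoint : ∀ ts → Right ts → ¬ (NN ts ⊎ NM ts ⊎ MN ts)
  right-disjoint _ (_ ∷ _ , _ , refl) (inj₁ (_ ∷ _ ∷ _ , q , refl)) =
    ¬N-leaf (proj₁ (head-N q))
  right-disjoint _ (_ ∷ _ , _ , refl) (inj₂ (inj₁ (_ ∷ _ ∷ _ , q , refl))) =
    ¬N-leaf (proj₁ (head-N (proj₂ (proj₂ (head-M q)))))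
  right-disjoint _ (_ ∷ _ , _ , refl) (inj₂ (inj₂ (_ ∷ _ ∷ _ , q , refl))) =
    ¬M-leaf (proj₁ (head-M q))

  nn-disjoint : ∀ ts → NN ts → ¬ (NM ts ⊎ MN ts)
  nn-disjoint _ (_ ∷ _ ∷ _ , p , refl) (inj₁ (_ ∷ _ ∷ _ , q , refl)) =
    ¬M-leaf (subst M (N-node-leaf (proj₁ (head-N (proj₂ (proj₂ (head-N p))))))
      (proj₁ (head-M q)))
  nn-disjoint _ (_ ∷ _ ∷ _ , p , refl) (inj₂ (_ ∷ _ ∷ _ , q , refl)) =
    ¬N-leaf (subst N (N-node-leaf (proj₁ (head-N (proj₂ (proj₂ (head-N p))))))
      (proj₁ (head-N (proj₂ (proj₂ (head-M q))))))

  nm-mn-disjoint : ∀ ts → NM ts → ¬ MN ts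
  nm-mn-disjoint _ (_ ∷ _ ∷ _ , p , refl) (_ ∷ _ ∷ _ , q , refl) =
    N-M-disjoint (proj₁ (head-N (proj₂ (proj₂ (head-M p))))) (proj₁ (head-M q))

cons-N : ∀ {t r n} {ts : Vec Tree r} → N t → NForest n ts → ∃ λ k → NForest k (t ∷ ts)
cons-N single p = _ , single p
cons-N (both na nb) p = _ , both (proj₂ (cons-N na (proj₂ (cons-N nb p))))

cons-M : ∀ {t r n} {ts : Vec Tree r} → M t → NForest n ts → ∃ λ k → MForest k (t ∷ ts)
cons-M (right na) p = _ , right (proj₂ (cons-N na p))
cons-M (nn na nb) p = _ , nn (proj₂ (cons-N na (proj₂ (cons-N nb p))))
cons-M (nm m na) p = _ , nm (proj₂ (cons-M m (proj₂ (cons-N na p))))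
cons-M (mn m na) p = _ , mn (proj₂ (cons-M m (proj₂ (cons-N na p))))

size : Tree → ℕ
size leaf       = 0
size (node l r) = size l + suc (size r)

sizes : ∀ {r} → Vec Tree r → ℕ
sizes []       = 0
sizes (t ∷ ts) = size t + sizes ts

-- A binary tree with n internal nodes spends two entries on each of them and one on each of its n +
-- 1 leaves, 3 n + 1 in all.
sizes-N : ∀ {r n} {ts : Vec Tree r} → NForest n ts → sizes ts ≡ 3 * n + r
sizes-N [] = refl
sizes-N {suc r} {n} (single p) = trans (cong suc (sizes-N p)) (sym (+-suc (3 * n) r))
sizes-N {suc r} {suc n} (both {a = a} {b} {ts} p) = begin
  size a + suc (size b + 1) + sizes ts       ≡⟨ lemma₁ (size a) (size b) (sizes ts) ⟩
  size a + (size b + sizes ts) + 2           ≡⟨ cong (_+ 2) (sizes-N p) ⟩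
  3 * n + suc (suc r) + 2                    ≡⟨ lemma₂ n r ⟩
  3 * suc n + suc r                          ∎
  where
  open ≡-Reasoning
  lemma₁ : ∀ a b s → a + suc (b + 1) + s ≡ a + (b + s) + 2
  lemma₁ = solve-∀
  lemma₂ : ∀ n r → 3 * n + suc (suc r) + 2 ≡ 3 * suc n + suc r
  lemma₂ = solve-∀

-- The first tree has one entry less than a Catalan tree of the same grade; the maximum appended to
-- it in `JTree⇒forest` makes up for this.
sizes-M : ∀ {r n} {ts : Vec Tree (suc r)} → MForest n ts → sizes ts ≡ 3 * n + r
sizes-M {r} {suc n} (right {a = a} {ts} p) = begin
  suc (size a + 1) + sizes ts      ≡⟨ lemma₁ (size a) (sizes ts) ⟩
  size a + sizes ts + 2            ≡⟨ cong (_+ 2) (sizes-N p) ⟩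
  3 * n + suc r + 2                ≡⟨ lemma₂ n r ⟩
  3 * suc n + r                    ∎
  where
  open ≡-Reasoning
  lemma₁ : ∀ a s → suc (a + 1) + s ≡ a + s + 2
  lemma₁ = solve-∀
  lemma₂ : ∀ n r → 3 * n + suc r + 2 ≡ 3 * suc n + r
  lemma₂ = solve-∀
sizes-M {r} {suc n} (nn {a = a} {b} {ts} p) = begin
  size a + suc (size b) + sizes ts      ≡⟨ lemma₁ (size a) (size b) (sizes ts) ⟩
  size a + (size b + sizes ts) + 1      ≡⟨ cong (_+ 1) (sizes-N p) ⟩
  3 * n + suc (suc r) + 1               ≡⟨ lemma₂ n r ⟩
  3 * suc n + r                         ∎
  where
  open ≡-Reasoning
  lemma₁ : ∀ a b s → a + suc b + s ≡ a + (b + s) + 1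
  lemma₁ = solve-∀
  lemma₂ : ∀ n r → 3 * n + suc (suc r) + 1 ≡ 3 * suc n + r
  lemma₂ = solve-∀
sizes-M {r} {suc n} (nm {m = m} {a} {ts} p) = begin
  size a + suc (size m + 1) + sizes ts  ≡⟨ lemma₁ (size a) (size m) (sizes ts) ⟩
  size m + (size a + sizes ts) + 2      ≡⟨ cong (_+ 2) (sizes-M p) ⟩
  3 * n + suc r + 2                     ≡⟨ lemma₂ n r ⟩
  3 * suc n + r                         ∎
  where
  open ≡-Reasoning
  lemma₁ : ∀ a m s → a + suc (m + 1) + s ≡ m + (a + s) + 2
  lemma₁ = solve-∀
  lemma₂ : ∀ n r → 3 * n + suc r + 2 ≡ 3 * suc n + r
  lemma₂ = solve-∀
sizes-M {r} {suc n} (mn {m = m} {a} {ts} p) = begin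
  size m + suc (size a + 1) + sizes ts  ≡⟨ lemma₁ (size a) (size m) (sizes ts) ⟩
  size m + (size a + sizes ts) + 2      ≡⟨ cong (_+ 2) (sizes-M p) ⟩
  3 * n + suc r + 2                     ≡⟨ lemma₂ n r ⟩
  3 * suc n + r                         ∎
  where
  open ≡-Reasoning
  lemma₁ : ∀ a m s → m + suc (a + 1) + s ≡ m + (a + s) + 2
  lemma₁ = solve-∀
  lemma₂ : ∀ n r → 3 * n + suc r + 2 ≡ 3 * suc n + r
  lemma₂ = solve-∀

-- Excess

-- corner t says that the box (1 , a) of the encoding of t is occupied: appending a
-- new maximum then occupies no new box.
corner : Tree → Bool
corner (node (node _ _) leaf) = true
corner _                      = false

#boxes : Tree → ℕ
#boxes leaf                   = 0
#boxes (node leaf r)          = #boxes r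
#boxes (node l@(node _ _) r) = (if corner l then 0 else 1) + #boxes l + #boxes r

-- The excess of a nonempty tree with n entries and k occupied boxes is
-- 2 n − 3 k − 1. The index of NonCornerExcess is one less than the excess, so that
-- nonnegativity is built in.
mutual
  data Excess : ℕ → Tree → Set where
    cor : ∀ {e t} → CornerExcess e t → Excess e t
    non : ∀ {e t} → NonCornerExcess e t → Excess (suc e) t

  data CornerExcess : ℕ → Tree → Set where
    cor : ∀ {e l} → CornerExcess e l → CornerExcess (2 + e) (node l leaf)
    non : ∀ {e l} → NonCornerExcess e l → CornerExcess e (node l leaf)

  data NonCornerExcess : ℕ → Tree → Set where
    single  : NonCornerExcess 0 (node leaf leaf)
    right   : ∀ {e r} → Excess e r → NonCornerExcess (suc e) (node leaf r)
    cor     : ∀ {d e l r} → CornerExcess d l → Excess e r → NonCornerExcess (2 + d + e) (node l r)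
    non     : ∀ {d e l r} → NonCornerExcess d l → Excess e r → NonCornerExcess (d + e) (node l r)

-- Totality of the relation. As its indices are natural numbers, this contains the nonnegativity of
-- the excess.
excess : ∀ l r → ∃ λ e → Excess e (node l r)
excess leaf leaf = _ , non single
excess leaf (node a b) = _ , non (right (proj₂ (excess a b)))
excess (node a b) leaf with excess a b
... | _ , cor x = _ , cor (cor x)
... | _ , non x = _ , cor (non x)
excess (node a b) (node c d) with excess a b
... | _ , cor x = _ , non (cor x (proj₂ (excess c d)))
... | _ , non x = _ , non (non x (proj₂ (excess c d)))

¬excess-leaf : ∀ {e} → ¬ Excess e leaf
¬excess-leaf (cor ())
¬excess-leaf (non ())

noncorner : ∀ {e t} → NonCornerExcess e t → corner t ≡ false
noncorner single = refl
noncorner (right _) = refl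
noncorner {t = node _ leaf} (cor _ x) = ⊥-elim (¬excess-leaf x)
noncorner {t = node leaf (node _ _)} (cor _ x) = refl
noncorner {t = node (node _ _) (node _ _)} (cor _ x) = refl
noncorner {t = node _ leaf} (non _ x) = ⊥-elim (¬excess-leaf x)
noncorner {t = node leaf (node _ _)} (non _ x) = refl
noncorner {t = node (node _ _) (node _ _)} (non _ x) = refl

is-corner : ∀ {e t} → CornerExcess e t → corner t ≡ true
is-corner {t = node (node _ _) leaf} _ = refl
is-corner {t = node leaf leaf} (cor ())
is-corner {t = node leaf leaf} (non ())

#boxes-corner : ∀ {e l} r → CornerExcess e l → #boxes (node l r) ≡ #boxes l + #boxes r
#boxes-corner {l = node _ _} r x rewrite is-corner x = refl

#boxes-noncorner : ∀ {e l} r → NonCornerExcess e l → #boxes (node l r) ≡ suc (#boxes l + #boxes r)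
#boxes-noncorner {l = node _ _} r x rewrite noncorner x = refl

Balance : ℕ → Tree → Set
Balance e t = 2 * size t ≡ 3 * #boxes t + 1 + e

mutual
  -- The new maximum is worth 2, a new box costs 3, and two nonempty parts share a single constant
  -- -1, which is worth 1 more.
  balance : ∀ {e t} → Excess e t → Balance e t
  balance (cor x) = balance-corner x
  balance (non x) = balance-noncorner x

  balance-corner : ∀ {e t} → CornerExcess e t → Balance e t
  balance-corner {suc (suc e)} {node l leaf} (cor x) rewrite #boxes-corner leaf x = begin
    2 * (size l + 1)                            ≡⟨ *-distribˡ-+ 2 (size l) 1 ⟩
    2 * size l + 2                              ≡⟨ cong (_+ 2) (balance-corner x) ⟩
    3 * #boxes l + 1 + e + 2                    ≡⟨ lemma (#boxes l) e ⟩
    3 * (#boxes l + 0) + 1 + suc (suc e)        ∎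
    where
    open ≡-Reasoning
    lemma : ∀ b e → 3 * b + 1 + e + 2 ≡ 3 * (b + 0) + 1 + suc (suc e)
    lemma = solve-∀
  balance-corner {e} {node l leaf} (non x) rewrite #boxes-noncorner leaf x = begin
    2 * (size l + 1)                            ≡⟨ *-distribˡ-+ 2 (size l) 1 ⟩
    2 * size l + 2                              ≡⟨ cong (_+ 2) (balance-noncorner x) ⟩
    3 * #boxes l + 1 + suc e + 2                ≡⟨ lemma (#boxes l) e ⟩
    3 * suc (#boxes l + 0) + 1 + e              ∎
    where
    open ≡-Reasoning
    lemma : ∀ b e → 3 * b + 1 + suc e + 2 ≡ 3 * suc (b + 0) + 1 + e
    lemma = solve-∀

  balance-noncorner : ∀ {e t} → NonCornerExcess e t → Balance (suc e) t
  balance-noncorner single = refl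
  balance-noncorner {suc e} {node leaf r} (right x) = begin
    2 * suc (size r)                   ≡⟨ *-distribˡ-+ 2 1 (size r) ⟩
    2 + 2 * size r                     ≡⟨ cong (2 +_) (balance x) ⟩
    2 + (3 * #boxes r + 1 + e)         ≡⟨ lemma (#boxes r) e ⟩
    3 * #boxes r + 1 + suc (suc e)     ∎
    where
    open ≡-Reasoning
    lemma : ∀ b e → 2 + (3 * b + 1 + e) ≡ 3 * b + 1 + suc (suc e)
    lemma = solve-∀
  balance-noncorner {t = node l r} (cor {d} {e} x y) rewrite #boxes-corner r x = begin
    2 * (size l + suc (size r))                                ≡⟨ lemma₁ (size l) (size r) ⟩
    2 * size l + 2 * size r + 2
      ≡⟨ cong₂ (λ u v → u + v + 2) (balance-corner x) (balance y) ⟩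
    (3 * #boxes l + 1 + d) + (3 * #boxes r + 1 + e) + 2        ≡⟨ lemma₂ (#boxes l) (#boxes r) d e ⟩
    3 * (#boxes l + #boxes r) + 1 + suc (2 + d + e)            ∎
    where
    open ≡-Reasoning
    lemma₁ : ∀ l r → 2 * (l + suc r) ≡ 2 * l + 2 * r + 2
    lemma₁ = solve-∀
    lemma₂ : ∀ b c d e → (3 * b + 1 + d) + (3 * c + 1 + e) + 2 ≡ 3 * (b + c) + 1 + suc (2 + d + e)
    lemma₂ = solve-∀
  balance-noncorner {t = node l r} (non {d} {e} x y) rewrite #boxes-noncorner r x = begin
    2 * (size l + suc (size r))                                ≡⟨ lemma₁ (size l) (size r) ⟩
    2 * size l + 2 * size r + 2
      ≡⟨ cong₂ (λ u v → u + v + 2) (balance-noncorner x) (balance y) ⟩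
    (3 * #boxes l + 1 + suc d) + (3 * #boxes r + 1 + e) + 2    ≡⟨ lemma₂ (#boxes l) (#boxes r) d e ⟩
    3 * suc (#boxes l + #boxes r) + 1 + suc (d + e)            ∎
    where
    open ≡-Reasoning
    lemma₁ : ∀ l r → 2 * (l + suc r) ≡ 2 * l + 2 * r + 2
    lemma₁ = solve-∀
    lemma₂ : ∀ b c d e →
      (3 * b + 1 + suc d) + (3 * c + 1 + e) + 2 ≡ 3 * suc (b + c) + 1 + suc (d + e)
    lemma₂ = solve-∀

N⇒excess : ∀ {t} → N t → NonCornerExcess 0 t
N⇒excess single = single
N⇒excess (both a b) = non (N⇒excess a) (cor (non (N⇒excess b)))

M⇒excess : ∀ {t} → M t → NonCornerExcess 1 t
M⇒excess (right a) = right (cor (non (N⇒excess a)))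
M⇒excess (nn a b) = non (N⇒excess a) (non (N⇒excess b))
M⇒excess (nm m a) = non (N⇒excess a) (cor (non (M⇒excess m)))
M⇒excess (mn m a) = non (M⇒excess m) (cor (non (N⇒excess a)))

-- A sum 0 has both summands 0, and a right part of excess 0 must be a maximum appended to a tree
-- without corner of index 0. The index is a variable with an equation because `d + e` does not
-- unify with a numeral.
excess⇒N : ∀ {e t} → NonCornerExcess e t → e ≡ 0 → N t
excess⇒N single _ = single
excess⇒N (non {zero} {zero} x (cor (non y))) _ = both (excess⇒N x refl) (excess⇒N y refl)

-- The sum 1 is 0 + 1 or 1 + 0. A right part of excess 1 may or may not have a corner, which
-- separates `nm` from `nn`; the constructor `cor` already adds 2.
excess⇒M : ∀ {e t} → NonCornerExcess e t → e ≡ 1 → M t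
excess⇒M (right (cor (non x))) refl = right (excess⇒N x refl)
excess⇒M (non {zero} {suc zero} x (cor (non y))) _ = nm (excess⇒M y refl) (excess⇒N x refl)
excess⇒M (non {zero} {suc zero} x (non y)) _ = nn (excess⇒N x refl) (excess⇒N y refl)
excess⇒M (non {suc zero} {zero} x (cor (non y))) _ = mn (excess⇒M x refl) (excess⇒N y refl)

-- The trees with 3i + 1 entries and 2i boxes

JTree : ℕ → Tree → Set
JTree i t = size t ≡ 3 * i + 1 × #boxes t ≡ 2 * i

boxes-from-size : ∀ t i → Balance 1 t → size t ≡ 3 * i + 1 → #boxes t ≡ 2 * i
boxes-from-size t i bal s = *-cancelˡ-≡ _ _ 3 (+-cancelʳ-≡ 2 _ _ (begin
  3 * #boxes t + 2      ≡⟨ +-assoc (3 * #boxes t) 1 1 ⟨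
  3 * #boxes t + 1 + 1  ≡⟨ bal ⟨
  2 * size t            ≡⟨ cong (2 *_) s ⟩
  2 * (3 * i + 1)       ≡⟨ lemma i ⟩
  3 * (2 * i) + 2       ∎))
  where
  open ≡-Reasoning
  lemma : ∀ i → 2 * (3 * i + 1) ≡ 3 * (2 * i) + 2
  lemma = solve-∀

excess-of-JTree : ∀ {e} t i → Balance e t → JTree i t → e ≡ 1
excess-of-JTree {e} t i bal (s , b) = +-cancelˡ-≡ (3 * (2 * i) + 1) _ _ (begin
  3 * (2 * i) + 1 + e   ≡⟨ cong (λ b → 3 * b + 1 + e) b ⟨
  3 * #boxes t + 1 + e  ≡⟨ bal ⟨
  2 * size t            ≡⟨ cong (2 *_) s ⟩
  2 * (3 * i + 1)       ≡⟨ lemma i ⟩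
  3 * (2 * i) + 1 + 1   ∎)
  where
  open ≡-Reasoning
  lemma : ∀ i → 2 * (3 * i + 1) ≡ 3 * (2 * i) + 1 + 1
  lemma = solve-∀

cancel-3*+ : ∀ {c} k i → 3 * k + c ≡ 3 * i + c → k ≡ i
cancel-3*+ {c} k i eq = *-cancelˡ-≡ k i 3 (+-cancelʳ-≡ c _ _ eq)

-- In a corner tree of excess 1 the left subtree has no corner, since otherwise the excess would be
-- at least 2; hence it has excess 2 and belongs to `M`. The size identifies the grade `k` with `i`.
JTree⇒forest : ∀ i t → JTree i t → NForest i (t ∷ []) ⊎ ∃ λ m → MForest i (m ∷ []) × t ≡ node m leaf
JTree⇒forest i leaf (s , _) with () ← trans s (+-comm (3 * i) 1)
JTree⇒forest i t@(node l r) j@(s , _) with excess l r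
... | e , x with refl ← excess-of-JTree {e} t i (balance x) j with x
... | non x
  with k , f ← cons-N (excess⇒N x refl) []
  with refl ← cancel-3*+ {1} k i (trans (sym (sizes-N f)) (trans (+-identityʳ (size t)) s)) = inj₁ f
... | cor (non x)
  with k , f ← cons-M (excess⇒M x refl) []
  with refl ← cancel-3*+ {1} k i (trans (cong (_+ 1)
     (trans (sym (+-identityʳ (3 * k))) (trans (sym (sizes-M f)) (+-identityʳ (size l))))) s) =
  inj₂ (l , f , refl)

N⇒JTree : ∀ i t → NForest i (t ∷ []) → JTree i t
N⇒JTree i t f = s , boxes-from-size t i (balance-noncorner (N⇒excess (proj₁ (head-N f)))) s
  where s = trans (sym (+-identityʳ (size t))) (sizes-N f)

M⇒JTree : ∀ i m → MForest i (m ∷ []) → JTree i (node m leaf)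
M⇒JTree i m f = s , boxes-from-size (node m leaf) i (balance-corner (non (M⇒excess (proj₁ (head-M f))))) s
  where s = cong (_+ 1) (trans (sym (+-identityʳ (size m))) (trans (sizes-M f) (+-identityʳ (3 * i))))

counted-JTree : ∀ i → Counted (JTree i) (#N 1 i + #M 0 i)
counted-JTree i =
  counted-⇔
    (λ { _ (inj₁ (_ ∷ [] , f , refl)) → N⇒JTree i _ f
       ; _ (inj₂ (_ ∷ [] , f , refl)) → M⇒JTree i _ f })
    (λ t j → [ (λ f → inj₁ (t ∷ [] , f , refl))
             , (λ { (m , f , refl) → inj₂ (m ∷ [] , f , refl) }) ]′ (JTree⇒forest i t j))
    (counted-⊎ (λ { _ (_ ∷ [] , f , refl) (_ ∷ [] , g , refl) →
                    ¬M-leaf (subst M (N-node-leaf (proj₁ (head-N f))) (proj₁ (head-M g))) })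
      (counted-map Vec.head (λ { {_ ∷ []} {_ ∷ []} refl → refl }) (counted-NForest 1 i))
      (counted-map (λ ts → node (Vec.head ts) leaf) (λ { {_ ∷ []} {_ ∷ []} refl → refl })
        (counted-MForest 0 i)))

-- Closed forms

pascal : ∀ n k → suc n C suc k ≡ n C k + n C suc k
pascal n k = sym (nCk+nC[k+1]≡[n+1]C[k+1] n k)

#N-zero : ∀ r → #N r 0 ≡ 1
#N-zero zero    = refl
#N-zero (suc r) = #N-zero r

nC0≡1 : ∀ n → n C 0 ≡ 1
nC0≡1 n = trans (nCk≡nC[n∸k] {0} {n} z≤n) (nCn≡1 n)

middle-C : ∀ n → suc (n + n) C suc n ≡ suc (n + n) C n
middle-C n = trans (nCk≡nC[n∸k] (s≤s (m≤m+n n n))) (cong (suc (n + n) C_) (m+n∸m≡n (suc n) n))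

-- Pascal's rule on both sides: two neighbouring ballot identities in row `m` add up to one in row
-- `m + 1`.
ballot-step : ∀ a b m n →
  a + m C suc n ≡ m C (2 + n) → b + m C n ≡ m C suc n →
  a + b + suc m C suc n ≡ suc m C (2 + n)
ballot-step a b m n a≡ b≡ = begin
  a + b + suc m C suc n                ≡⟨ cong (a + b +_) (pascal m n) ⟩
  a + b + (m C n + m C suc n)          ≡⟨ lemma a b (m C n) (m C suc n) ⟩
  b + m C n + (a + m C suc n)          ≡⟨ cong₂ _+_ b≡ a≡ ⟩
  m C suc n + m C (2 + n)              ≡⟨ pascal m (suc n) ⟨
  suc m C (2 + n)                      ∎
  where
  open ≡-Reasoning
  lemma : ∀ a b c d → a + b + (c + d) ≡ b + c + (a + d)
  lemma = solve-∀

-- Ballot numbers, with the subtraction moved across.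
#N-ballot : ∀ r n {m} → m ≡ n + n + r →
            #N (suc r) (suc n) + (2 + m) C n ≡ (2 + m) C suc n
#N-ballot zero zero refl = refl
#N-ballot (suc r) zero {suc m} eq = begin
  #N (suc r) 1 + #N r 0 + (3 + m) C 0
    ≡⟨ cong₂ (λ u v → #N (suc r) 1 + u + v) (#N-zero r) (nC0≡1 (3 + m)) ⟩
  #N (suc r) 1 + 1 + 1
    ≡⟨ +-comm (#N (suc r) 1 + 1) 1 ⟩
  1 + (#N (suc r) 1 + 1)
    ≡⟨ cong₂ (λ u v → u + (#N (suc r) 1 + v)) (nC0≡1 (2 + m)) (nC0≡1 (2 + m)) ⟨
  (2 + m) C 0 + (#N (suc r) 1 + (2 + m) C 0)
    ≡⟨ cong ((2 + m) C 0 +_) (#N-ballot r zero (suc-injective eq)) ⟩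
  (2 + m) C 0 + (2 + m) C 1
    ≡⟨ pascal (2 + m) 0 ⟨
  (3 + m) C 1 ∎
  where open ≡-Reasoning
#N-ballot zero (suc n) {suc m} eq =
  -- The empty forest has no positive grade, so the first summand is 0; its ballot identity is the
  -- equality of the two middle binomials in an odd row.
  ballot-step 0 (#N 2 (suc n)) (2 + m) n
    (subst (λ k → k C suc n ≡ k C (2 + n))
      (cong suc (trans (sym (+-identityʳ (suc n + suc n))) (sym eq)))
      (sym (middle-C (suc n))))
    (#N-ballot 1 n (trans (suc-injective eq) (lemma n)))
  where
  lemma : ∀ n → n + suc n + 0 ≡ n + n + 1
  lemma = solve-∀
#N-ballot (suc r) (suc n) {suc m} eq =
  ballot-step (#N (suc r) (2 + n)) (#N (3 + r) (suc n)) (2 + m) n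
    (#N-ballot r (suc n) m≡)
    (#N-ballot (2 + r) n (trans m≡ (lemma n r)))
  where
  m≡ : m ≡ suc n + suc n + r
  m≡ = suc-injective (trans eq (+-suc (suc n + suc n) r))
  lemma : ∀ n r → suc n + suc n + r ≡ n + n + (2 + r)
  lemma = solve-∀

-- The recurrence contains the inductive value `c + d` twice. One copy is absorbed by the ballot
-- identities of the two `#N` terms, the other is the missing summand in Pascal's rule.
#M-closed : ∀ r n {m} → m ≡ n + n + r → #M r (suc n) ≡ (1 + m) C n + (2 + m) C n
#M-closed r zero {m} _ =
  cong₂ _+_ (trans (#N-zero r) (sym (nC0≡1 (1 + m))))
    (trans (+-identityʳ (#N r 0)) (trans (#N-zero r) (sym (nC0≡1 (2 + m)))))
#M-closed r (suc n) {suc (suc m)} eq = begin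
  a + (b + (#M (suc r) (suc n) + #M (suc r) (suc n)))
    ≡⟨ cong (λ u → a + (b + (u + u))) (#M-closed (suc r) n m≡′) ⟩
  a + (b + (c + d + (c + d)))
    ≡⟨ lemma₁ a b c d ⟩
  c + (a + c) + (d + (b + d))
    ≡⟨ cong₂ (λ u v → c + u + (d + v)) (#N-ballot r n m≡) (#N-ballot (suc r) n m≡′) ⟩
  c + (2 + m) C suc n + (d + (3 + m) C suc n)
    ≡⟨ cong₂ _+_ (pascal (2 + m) n) (pascal (3 + m) n) ⟨
  (3 + m) C suc n + (4 + m) C suc n ∎
  where
  open ≡-Reasoning
  a = #N (suc r) (suc n)
  b = #N (2 + r) (suc n)
  c = (2 + m) C n
  d = (3 + m) C n
  lemma₁ : ∀ a b c d → a + (b + (c + d + (c + d))) ≡ c + (a + c) + (d + (b + d))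
  lemma₁ = solve-∀
  lemma₂ : ∀ n r → n + suc n + r ≡ suc (n + n + r)
  lemma₂ = solve-∀
  m≡ : m ≡ n + n + r
  m≡ = suc-injective (trans (suc-injective eq) (lemma₂ n r))
  m≡′ : suc m ≡ n + n + suc r
  m≡′ = trans (cong suc m≡) (sym (+-suc (n + n) r))
#M-closed r (suc n) {suc zero} eq with () ← trans (suc-injective eq) (cong (_+ r) (+-suc n n))

count-closed : ∀ i → 1 ≤ i → 2 * (#N 1 i + #M 0 i) ≡ 3 * ((2 * i) C i)
count-closed (suc n) _ = begin
  2 * (#N 1 (suc n) + #M 0 (suc n))
    ≡⟨ cong (λ x → 2 * (#N 1 (suc n) + x)) (#M-closed 0 n (sym (+-identityʳ (n + n)))) ⟩
  2 * (#N 1 (suc n) + (p + q))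
    ≡⟨ lemma₁ (#N 1 (suc n)) p q ⟩
  2 * (#N 1 (suc n) + q) + (p + p)
    -- The ballot identity completes the Catalan number by `q` to the central binomial `c`, and `p`
    -- is half of `c`.
    ≡⟨ cong₂ (λ x y → 2 * x + y) (#N-ballot 0 n (sym (+-identityʳ (n + n)))) p+p≡c ⟩
  2 * c + c
    ≡⟨ lemma₂ c ⟩
  3 * c
    ≡⟨ cong (λ m → 3 * (m C suc n)) (lemma₃ n) ⟩
  3 * ((2 * suc n) C suc n) ∎
  where
  open ≡-Reasoning
  p = (1 + (n + n)) C n
  q = (2 + (n + n)) C n
  c = (2 + (n + n)) C suc n
  p+p≡c : p + p ≡ c
  p+p≡c = trans (cong (p +_) (sym (middle-C n))) (sym (pascal (suc (n + n)) n))
  lemma₁ : ∀ a p q → 2 * (a + (p + q)) ≡ 2 * (a + q) + (p + p)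
  lemma₁ = solve-∀
  lemma₂ : ∀ c → 2 * c + c ≡ 3 * c
  lemma₂ = solve-∀
  lemma₃ : ∀ n → 2 + (n + n) ≡ 2 * suc n
  lemma₃ = solve-∀

-- The second summand of the recurrence always keeps at least one tree, down to grade 0.
#N-pos : ∀ r n → 0 < #N (suc r) n
#N-pos r zero rewrite #N-zero r = s≤s z≤n
#N-pos r (suc n) = ≤-trans (#N-pos (suc r) n) (m≤n+m _ (#N r (suc n)))

-- Positions and left-to-right minima

<ᵇ-true : ∀ {m n} → m < n → (m <ᵇ n) ≡ true
<ᵇ-true = to T-≡ ∘ <⇒<ᵇ

true-< : ∀ {m n} → (m <ᵇ n) ≡ true → m < n
true-< {m} {n} = <ᵇ⇒< m n ∘ from T-≡

<ᵇ-false : ∀ {m n} → n ≤ m → (m <ᵇ n) ≡ false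
<ᵇ-false n≤m = ¬-not (λ eq → <⇒≱ (true-< eq) n≤m)

false≢true : false ≢ true
false≢true ()

false-≥ : ∀ {m n} → (m <ᵇ n) ≡ false → n ≤ m
false-≥ eq = ≮⇒≥ (λ m<n → false≢true (trans (sym eq) (<ᵇ-true m<n)))

bool-ext : ∀ {a b : Bool} → (a ≡ true → b ≡ true) → (b ≡ true → a ≡ true) → a ≡ b
bool-ext {true} f g = sym (f refl)
bool-ext {false} {true} f g = g refl
bool-ext {false} {false} f g = refl

-- Replaces filtering `upTo`, because a count over positions splits at the position of the maximum.
count : (ℕ → Bool) → ℕ → ℕ
count g zero    = 0
count g (suc n) = (if g 0 then 1 else 0) + count (g ∘ suc) n

count-+ : ∀ g m n → count g (m + n) ≡ count g m + count (λ k → g (m + k)) n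
count-+ g zero n = refl
count-+ g (suc m) n =
  trans (cong (b +_) (count-+ (g ∘ suc) m n)) (sym (+-assoc b _ _))
  where b = if g 0 then 1 else 0

count-cong : ∀ {g h} n → (∀ k → k < n → g k ≡ h k) → count g n ≡ count h n
count-cong zero eq = refl
count-cong (suc n) eq =
  cong₂ (λ b m → (if b then 1 else 0) + m) (eq 0 z<s) (count-cong n (λ k k<n → eq (suc k) (s<s k<n)))

count-none : ∀ {g} n → (∀ k → k < n → g k ≡ false) → count g n ≡ 0
count-none zero none = refl
count-none (suc n) none rewrite none 0 z<s = count-none n (λ k k<n → none (suc k) (s<s k<n))

length-filter-applyUpTo : ∀ (g : ℕ → Bool) (h : ℕ → ℕ) n →
  length (filterᵇ g (applyUpTo h n)) ≡ count (g ∘ h) n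
length-filter-applyUpTo g h zero = refl
length-filter-applyUpTo g h (suc n) with g (h 0)
... | true  = cong suc (length-filter-applyUpTo g (h ∘ suc) n)
... | false = length-filter-applyUpTo g (h ∘ suc) n

filter-filter : ∀ {A : Set} (f g : A → Bool) xs →
                filterᵇ f (filterᵇ g xs) ≡ filterᵇ (λ x → g x ∧ f x) xs
filter-filter f g [] = refl
filter-filter f g (x ∷ xs) with g x
... | false = filter-filter f g xs
... | true with f x
...   | true  = cong (x ∷_) (filter-filter f g xs)
...   | false = filter-filter f g xs

and-cong : ∀ {g h : ℕ → Bool} f n → (∀ j → j < n → g (f j) ≡ h (f j)) →
           and (map g (applyUpTo f n)) ≡ and (map h (applyUpTo f n))
and-cong f zero eq = refl
and-cong f (suc n) eq = cong₂ _∧_ (eq 0 z<s) (and-cong (f ∘ suc) n (λ j j<n → eq (suc j) (s<s j<n)))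

and-intro : ∀ {g : ℕ → Bool} f n → (∀ j → j < n → g (f j) ≡ true) → and (map g (applyUpTo f n)) ≡ true
and-intro f zero eq = refl
and-intro f (suc n) eq rewrite eq 0 z<s = and-intro (f ∘ suc) n (λ j j<n → eq (suc j) (s<s j<n))

and-elim : ∀ {g : ℕ → Bool} f n → and (map g (applyUpTo f n)) ≡ true → ∀ j → j < n → g (f j) ≡ true
and-elim {g} f (suc n) eq j j<n with g (f 0) in g0
and-elim f (suc n) eq zero j<n | true = g0
and-elim f (suc n) eq (suc j) j<n | true = and-elim (f ∘ suc) n eq j (s<s⁻¹ j<n)

isMin : List ℕ → ℕ → Bool
isMin π i = and (map (λ j → at π i <ᵇ at π j) (upTo i))

isMin-intro : ∀ π i → (∀ j → j < i → at π i < at π j) → isMin π i ≡ true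
isMin-intro π i h = and-intro id i (λ j j<i → <ᵇ-true (h j j<i))

isMin-elim : ∀ π i → isMin π i ≡ true → ∀ j → j < i → at π i < at π j
isMin-elim π i eq j j<i = true-< (and-elim id i eq j j<i)

at-++ˡ : ∀ xs {ys p} → p < length xs → at (xs ++ ys) p ≡ at xs p
at-++ˡ (x ∷ xs) {p = zero} _ = refl
at-++ˡ (x ∷ xs) {p = suc p} p< = at-++ˡ xs (s<s⁻¹ p<)

at-++ʳ : ∀ xs {ys} p → at (xs ++ ys) (length xs + p) ≡ at ys p
at-++ʳ [] p = refl
at-++ʳ (x ∷ xs) p = at-++ʳ xs p

data Position (s : ℕ) : ℕ → Set where
  left  : ∀ {p} → p < s → Position s p
  mid   : Position s s
  right : ∀ q → Position s (suc s + q)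

position : ∀ s p → Position s p
position zero zero = mid
position zero (suc p) = right p
position (suc s) zero = left z<s
position (suc s) (suc p) with position s p
... | left p<s = left (s<s p<s)
... | mid = mid
... | right q = right q

#mins : List ℕ → ℕ
#mins π = count (isMin π) (length π)

-- Box (i , j) of the encoding collects the positions with row i ∸ 1 and column j:
-- the row is counted from 0 here and from 1 in the encoding.
row col : List ℕ → ℕ → ℕ
row π p = count (λ k → isMin π k ∧ (at π p <ᵇ at π k)) (length π)
col π p = count (λ k → isMin π k ∧ (k <ᵇ p)) (length π)

module Split (σ τ : List ℕ) (m : ℕ) where
  π : List ℕ
  π = σ ++ m ∷ τ

  s t : ℕ
  s = length σ
  t = length τ

  at-left : ∀ {p} → p < s → at π p ≡ at σ p
  at-left = at-++ˡ σ

  at-mid : at π s ≡ m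
  at-mid = trans (cong (at π) (sym (+-identityʳ s))) (at-++ʳ σ 0)

  at-right : ∀ q → at π (suc s + q) ≡ at τ q
  at-right q = trans (cong (at π) (sym (+-suc s q))) (at-++ʳ σ (suc q))

  length-π : length π ≡ suc s + t
  length-π = trans (length-++ σ) (+-suc s t)

  left<length : ∀ {p} → p < s → p < length π
  left<length p<s = subst (_ <_) (sym length-π) (m≤n⇒m≤1+n (≤-trans p<s (m≤m+n s t)))

  mid<length : s < length π
  mid<length = subst (s <_) (sym length-π) (s≤s (m≤m+n s t))

  right<length : ∀ {q} → q < t → suc s + q < length π
  right<length q<t = subst (_ <_) (sym length-π) (+-monoʳ-< (suc s) q<t)

  right<length⁻ : ∀ {q} → suc s + q < length π → q < t
  right<length⁻ lt = +-cancelˡ-< (suc s) _ _ (subst (_ <_) length-π lt)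

module Layered (σ τ : List ℕ) (m : ℕ)
  (σ<m : ∀ {p} → p < length σ → at σ p < m)
  (τ<σ : ∀ {p q} → p < length σ → q < length τ → at τ q < at σ p)
  (τ<m : ∀ {q} → q < length τ → at τ q < m) where
  open Split σ τ m

  isMin-left : ∀ {p} → p < s → isMin π p ≡ isMin σ p
  isMin-left {p} p<s = and-cong id p λ j j<p →
    cong₂ _<ᵇ_ (at-left p<s) (at-left (<-trans j<p p<s))

  isMin-mid : 0 < s → isMin π s ≡ false
  isMin-mid 0<s = ¬-not λ eq → <-asym (σ<m 0<s)
    (subst₂ _<_ at-mid (at-left 0<s) (isMin-elim π s eq 0 0<s))

  τ<front : ∀ {k q} → q < t → k < suc s → at τ q < at π k
  τ<front {k} q<t k≤s with position s k
  ... | left k<s = subst (_ <_) (sym (at-left k<s)) (τ<σ k<s q<t)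
  ... | mid = subst (_ <_) (sym at-mid) (τ<m q<t)
  ... | right q = ⊥-elim (<⇒≱ k≤s (m≤m+n (suc s) q))

  -- All of σ and the maximum exceed every entry of τ, so only comparisons within τ decide.
  isMin-right : ∀ {q} → q < t → isMin π (suc s + q) ≡ isMin τ q
  isMin-right {q} q<t = bool-ext
    (λ eq → isMin-intro τ q λ j j<q → subst₂ _<_ (at-right q) (at-right j)
      (isMin-elim π (suc s + q) eq (suc s + j) (+-monoʳ-< (suc s) j<q)))
    (λ eq → isMin-intro π (suc s + q) λ j j< → subst (_< at π j) (sym (at-right q)) (below eq j j<))
    where
    below : isMin τ q ≡ true → ∀ j → j < suc s + q → at τ q < at π j
    below eq j j< with position s j
    ... | left j<s = τ<front q<t (m<n⇒m<1+n j<s)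
    ... | mid = τ<front q<t ≤-refl
    ... | right j′ = subst (_ <_) (sym (at-right j′))
            (isMin-elim τ q eq j′ (+-cancelˡ-< (suc s) _ _ j<))

  -- The minima of σ if σ is nonempty; otherwise 1, for the maximum itself is then a minimum.
  #front : ℕ
  #front = count (isMin π) (suc s)

  count-π : ∀ g → count g (length π) ≡ count g (suc s) + count (λ k → g (suc s + k)) t
  count-π g = trans (cong (count g) length-π) (count-+ g (suc s) t)

  count-front : ∀ g → count g (suc s) ≡ count g s + (if g s then 1 else 0)
  count-front g = begin
    count g (suc s)                                  ≡⟨ cong (count g) (+-comm 1 s) ⟩
    count g (s + 1)                                  ≡⟨ count-+ g s 1 ⟩
    count g s + ((if g (s + 0) then 1 else 0) + 0)
      ≡⟨ cong (count g s +_) (trans (+-identityʳ _) (cong (λ k → if g k then 1 else 0) (+-identityʳ s))) ⟩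
    count g s + (if g s then 1 else 0)               ∎
    where open ≡-Reasoning

  count-left-only : ∀ g → g s ≡ false → (∀ q → q < t → g (suc s + q) ≡ false) →
                    count g (length π) ≡ count g s
  count-left-only g gs gr = begin
    count g (length π)                                    ≡⟨ count-π g ⟩
    count g (suc s) + count (λ k → g (suc s + k)) t       ≡⟨ cong₂ _+_ (count-front g) (count-none t gr) ⟩
    count g s + (if g s then 1 else 0) + 0                ≡⟨ +-identityʳ _ ⟩
    count g s + (if g s then 1 else 0)                    ≡⟨ cong (λ b → count g s + (if b then 1 else 0)) gs ⟩
    count g s + 0                                         ≡⟨ +-identityʳ _ ⟩
    count g s                                             ∎
    where open ≡-Reasoning

  #front-nonempty : 0 < s → #front ≡ #mins σ
  #front-nonempty 0<s = begin
    count (isMin π) (suc s)                              ≡⟨ count-front (isMin π) ⟩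
    count (isMin π) s + (if isMin π s then 1 else 0)
      ≡⟨ cong₂ (λ c b → c + (if b then 1 else 0)) (count-cong s λ k → isMin-left) (isMin-mid 0<s) ⟩
    count (isMin σ) s + 0                                ≡⟨ +-identityʳ _ ⟩
    #mins σ                                              ∎
    where open ≡-Reasoning

  #mins-π : #mins π ≡ #front + #mins τ
  #mins-π = trans (count-π (isMin π)) (cong (#front +_) (count-cong t λ k → isMin-right))

  row-left : ∀ {p} → p < s → row π p ≡ row σ p
  row-left {p} p<s = trans
    (count-left-only _
      (cong (_∧ (at π p <ᵇ at π s)) (isMin-mid (≤-<-trans z≤n p<s)))
      (λ q q<t → trans (cong (isMin π (suc s + q) ∧_)
        (<ᵇ-false (subst₂ _≤_ (sym (at-right q)) (sym (at-left p<s)) (<⇒≤ (τ<σ p<s q<t)))))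
        (∧-zeroʳ _)))
    (count-cong s λ k k<s →
      cong₂ _∧_ (isMin-left k<s) (cong₂ _<ᵇ_ (at-left p<s) (at-left k<s)))

  col-left : ∀ {p} → p < s → col π p ≡ col σ p
  col-left {p} p<s = trans
    (count-left-only _
      (trans (cong (isMin π s ∧_) (<ᵇ-false (<⇒≤ p<s))) (∧-zeroʳ _))
      (λ q q<t → trans (cong (isMin π (suc s + q) ∧_)
        (<ᵇ-false (≤-trans (<⇒≤ p<s) (m≤n⇒m≤1+n (m≤m+n s q))))) (∧-zeroʳ _)))
    (count-cong s λ k k<s → cong (_∧ (k <ᵇ p)) (isMin-left k<s))

  row-mid : row π s ≡ 0
  row-mid = count-none (length π) λ k k< →
    trans (cong (isMin π k ∧_) (<ᵇ-false (subst (at π k ≤_) (sym at-mid) (≤m k k<)))) (∧-zeroʳ _)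
    where
    ≤m : ∀ k → k < length π → at π k ≤ m
    ≤m k k< with position s k
    ... | left k<s = subst (_≤ m) (sym (at-left k<s)) (<⇒≤ (σ<m k<s))
    ... | mid = ≤-reflexive at-mid
    ... | right q = subst (_≤ m) (sym (at-right q)) (<⇒≤ (τ<m (right<length⁻ k<)))

  col-mid : col π s ≡ #mins σ
  col-mid = trans
    (count-left-only _
      (trans (cong (isMin π s ∧_) (<ᵇ-false (≤-refl {s}))) (∧-zeroʳ _))
      (λ q q<t → trans (cong (isMin π (suc s + q) ∧_)
        (<ᵇ-false (m≤n⇒m≤1+n (m≤m+n s q)))) (∧-zeroʳ _)))
    (count-cong s λ k k<s →
      trans (cong₂ _∧_ (isMin-left k<s) (<ᵇ-true k<s)) (∧-identityʳ _))

  -- Every minimum in front of τ lies before and above all of τ, so rows and, in `col-right`,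
  -- columns grow by the same `#front`: a diagonal shift.
  row-right : ∀ {q} → q < t → row π (suc s + q) ≡ #front + row τ q
  row-right {q} q<t = trans (count-π _) (cong₂ _+_
    (count-cong (suc s) λ k k≤s →
      trans (cong (isMin π k ∧_) (<ᵇ-true (subst (_< at π k) (sym (at-right q)) (τ<front q<t k≤s))))
            (∧-identityʳ _))
    (count-cong t λ k k<t →
      cong₂ _∧_ (isMin-right k<t) (cong₂ _<ᵇ_ (at-right q) (at-right k))))

  col-right : ∀ {q} → col π (suc s + q) ≡ #front + col τ q
  col-right {q} = trans (count-π _) (cong₂ _+_
    (count-cong (suc s) λ k k≤s →
      trans (cong (isMin π k ∧_) (<ᵇ-true (≤-trans k≤s (m≤m+n (suc s) q)))) (∧-identityʳ _))
    (count-cong t λ k k<t →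
      cong₂ _∧_ (isMin-right k<t) (bool-ext
        (λ eq → <ᵇ-true (+-cancelˡ-< (suc s) _ _ (true-< {suc s + k} eq)))
        (λ eq → <ᵇ-true (+-monoʳ-< (suc s) (true-< {k} eq))))))

-- Occupied boxes of the permutation of a tree

-- The values run from b + 1 to b + `size t`. The right subtree takes the lowest ones, whence the
-- raised offset on the left.
perm : ℕ → Tree → List ℕ
perm b leaf       = []
perm b (node l r) = perm (b + size r) l ++ suc (b + size r + size l) ∷ perm b r

length-perm : ∀ b t → length (perm b t) ≡ size t
length-perm b leaf = refl
length-perm b (node l r) = trans (length-++ (perm (b + size r) l))
  (cong₂ (λ x y → x + suc y) (length-perm (b + size r) l) (length-perm b r))

perm-bounds : ∀ b t {p} → p < length (perm b t) →
              b < at (perm b t) p × at (perm b t) p ≤ b + size t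
perm-bounds b (node l r) {p} p< with position (length (perm (b + size r) l)) p
... | left p<s = subst (λ x → b < x × x ≤ b + size (node l r)) (sym (at-left p<s))
        (≤-<-trans (m≤m+n b (size r)) lo ,
         ≤-trans hi (subst (_≤ b + size (node l r)) (trans (cong (b +_) (+-comm (size l) (size r))) (sym (+-assoc b _ _)))
           (+-monoʳ-≤ b (+-monoʳ-≤ (size l) (n≤1+n (size r))))))
  where
  open Split (perm (b + size r) l) (perm b r) (suc (b + size r + size l))
  lo = proj₁ (perm-bounds (b + size r) l p<s)
  hi = proj₂ (perm-bounds (b + size r) l p<s)
... | mid = subst (λ x → b < x × x ≤ b + size (node l r)) (sym at-mid)
        (s≤s (≤-trans (m≤m+n b (size r)) (m≤m+n _ (size l))) ,
         ≤-reflexive (trans (cong suc (trans (+-assoc b _ _) (cong (b +_) (+-comm (size r) (size l)))))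
           (trans (sym (+-suc b (size l + size r))) (cong (b +_) (sym (+-suc (size l) (size r)))))))
  where open Split (perm (b + size r) l) (perm b r) (suc (b + size r + size l))
... | right q = subst (λ x → b < x × x ≤ b + size (node l r)) (sym (at-right q))
        (proj₁ ih , ≤-trans (proj₂ ih) (+-monoʳ-≤ b (≤-trans (n≤1+n (size r)) (m≤n+m _ (size l)))))
  where
  open Split (perm (b + size r) l) (perm b r) (suc (b + size r + size l))
  ih = perm-bounds b r (right<length⁻ p<)

module PermNode (b : ℕ) (l r : Tree) where
  σ τ : List ℕ
  σ = perm (b + size r) l
  τ = perm b r

  peak : ℕ
  peak = suc (b + size r + size l)

  σ<peak : ∀ {p} → p < length σ → at σ p < peak
  σ<peak p< = s≤s (proj₂ (perm-bounds (b + size r) l p<))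

  τ<σ : ∀ {p q} → p < length σ → q < length τ → at τ q < at σ p
  τ<σ p< q< = ≤-<-trans (proj₂ (perm-bounds b r q<)) (proj₁ (perm-bounds (b + size r) l p<))

  τ<peak : ∀ {q} → q < length τ → at τ q < peak
  τ<peak q< = s≤s (≤-trans (proj₂ (perm-bounds b r q<)) (m≤m+n _ (size l)))

  open Split σ τ peak public hiding (π)
  open Layered σ τ peak σ<peak τ<σ τ<peak public

-- Minima and occupied boxes read off from the tree

mins : Tree → ℕ
mins leaf                  = 0
mins (node leaf r)         = suc (mins r)
mins (node l@(node _ _) r) = mins l + mins r

0<mins-node : ∀ l r → 0 < mins (node l r)
0<mins-node leaf r = z<s
0<mins-node (node a b) r = ≤-trans (0<mins-node a b) (m≤m+n _ (mins r))

nonempty-perm : ∀ b l r → 0 < length (perm b (node l r))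
nonempty-perm b l r = subst (0 <_) (sym (length-perm b (node l r)))
  (≤-trans z<s (m≤n+m (suc (size r)) (size l)))

#mins-perm : ∀ b t → #mins (perm b t) ≡ mins t
#mins-perm b leaf = refl
#mins-perm b (node leaf r) = trans #mins-π (cong suc (#mins-perm b r))
  where open PermNode b leaf r
#mins-perm b (node l@(node l₁ l₂) r) = trans #mins-π
  (cong₂ _+_ (trans (#front-nonempty (nonempty-perm (b + size r) l₁ l₂)) (#mins-perm (b + size r) l)) (#mins-perm b r))
  where open PermNode b l r

shift : ℕ → ℕ × ℕ → ℕ × ℕ
shift k (i , j) = k + i , k + j

-- The boxes counted by `#boxes`. The box of the maximum is left out when `cells l` contains it
-- already, which keeps the list free of duplicates.
cells : Tree → List (ℕ × ℕ)
cells leaf                  = []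
cells (node leaf r)         = map (shift 1) (cells r)
cells (node l@(node _ _) r) =
  (if corner l then [] else (1 , mins l) ∷ []) ++ cells l ++ map (shift (mins l)) (cells r)

length-cells : ∀ t → length (cells t) ≡ #boxes t
length-cells leaf = refl
length-cells (node l r) with length-cells l | length-cells r
length-cells (node leaf r) | _ | ihʳ = trans (length-map (shift 1) (cells r)) ihʳ
length-cells (node l@(node _ _) r) | ihˡ | ihʳ with corner l
... | true  = trans (length-++ (cells l)) (cong₂ _+_ ihˡ (trans (length-map _ (cells r)) ihʳ))
... | false =
  cong suc (trans (length-++ (cells l)) (cong₂ _+_ ihˡ (trans (length-map _ (cells r)) ihʳ)))

-- A final maximum adds no minimum, so its box is the top box of the last column of the left
-- subtree: newly listed, or present by recursion.
corner-cell : ∀ t → corner t ≡ true → (1 , mins t) ∈ cells t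
corner-cell (node l r) _ with corner-cell l
corner-cell (node l@(node _ _) leaf) _ | ih rewrite +-identityʳ (mins l) with corner l
... | true  = ∈-++⁺ˡ (ih refl)
... | false = here refl

-- The possible origins of a box, `top` being allowed even if the box is not new; this hides the
-- case distinction on `corner`.
data NodeCell (l r : Tree) : ℕ × ℕ → Set where
  top   : NodeCell l r (1 , mins l)
  left  : ∀ {c} → c ∈ cells l → NodeCell l r c
  right : ∀ {c} → c ∈ cells r → NodeCell l r (shift (mins l) c)

∈-cells-node⁻ : ∀ a b r {c} → c ∈ cells (node (node a b) r) → NodeCell (node a b) r c
∈-cells-node⁻ a b r c∈ with ∈-++⁻ (if corner (node a b) then [] else (1 , mins (node a b)) ∷ []) c∈
... | inj₁ c∈′ with corner (node a b)
∈-cells-node⁻ a b r c∈ | inj₁ (here refl) | false = top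
∈-cells-node⁻ a b r c∈ | inj₂ c∈′ with ∈-++⁻ (cells (node a b)) c∈′
... | inj₁ c∈l = left c∈l
... | inj₂ c∈r with _ , d∈ , refl ← ∈-map⁻ (shift (mins (node a b))) c∈r = right d∈

∈-cells-node⁺ : ∀ a b r {c} → NodeCell (node a b) r c → c ∈ cells (node (node a b) r)
∈-cells-node⁺ a b r top with corner (node a b) in eq
... | true  = ∈-++⁺ˡ (corner-cell (node a b) eq)
... | false = here refl
∈-cells-node⁺ a b r (left c∈) =
  ∈-++⁺ʳ (if corner (node a b) then [] else (1 , mins (node a b)) ∷ []) (∈-++⁺ˡ c∈)
∈-cells-node⁺ a b r (right c∈) =
  ∈-++⁺ʳ (if corner (node a b) then [] else (1 , mins (node a b)) ∷ [])
    (∈-++⁺ʳ (cells (node a b)) (∈-map⁺ (shift (mins (node a b))) c∈))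

cells-bounds : ∀ t {i j} → (i , j) ∈ cells t → 1 ≤ i × i ≤ j × j ≤ mins t
cells-bounds (node l r) c∈ with cells-bounds l | cells-bounds r
cells-bounds (node leaf r) c∈ | _ | ihʳ with (i , j) , d∈ , refl ← ∈-map⁻ (shift 1) c∈ =
  let (_ , i≤j , j≤) = ihʳ d∈ in z<s , s≤s i≤j , s≤s j≤
cells-bounds (node (node a b) r) c∈ | ihˡ | ihʳ with ∈-cells-node⁻ a b r c∈
... | top = ≤-refl , 0<mins-node a b , m≤m+n _ (mins r)
... | left d∈ = let (1≤i , i≤j , j≤) = ihˡ d∈ in
      1≤i , i≤j , ≤-trans j≤ (m≤m+n _ (mins r))
... | right d∈ = let (1≤i , i≤j , j≤) = ihʳ d∈ in
      ≤-trans 1≤i (m≤n+m _ k) , +-monoʳ-≤ k i≤j , +-monoʳ-≤ k j≤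
  where k = mins (node a b)

shift-injective : ∀ k {c d} → shift k c ≡ shift k d → c ≡ d
shift-injective k eq = cong₂ _,_ (+-cancelˡ-≡ k _ _ (cong proj₁ eq)) (+-cancelˡ-≡ k _ _ (cong proj₂ eq))

-- Without a corner, only shifted boxes reach the last column, and these lie in row 2 or below.
top-cell⇒corner : ∀ t → (1 , mins t) ∈ cells t → corner t ≡ true
top-cell⇒corner (node leaf r) c∈ with (i , j) , d∈ , eq ← ∈-map⁻ (shift 1) c∈
  with refl ← cong proj₁ eq with () ← proj₁ (cells-bounds r d∈)
top-cell⇒corner (node (node _ _) leaf) c∈ = refl
top-cell⇒corner (node l@(node a b) r@(node c d)) c∈ = ⊥-elim (absurd (∈-cells-node⁻ a b r c∈) refl)
  where
  l<l+r : mins l < mins l + mins r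
  l<l+r = m<m+n (mins l) (0<mins-node c d)
  absurd : ∀ {e} → NodeCell l r e → e ≢ (1 , mins l + mins r)
  absurd top eq = <⇒≢ l<l+r (cong proj₂ eq)
  absurd (left d∈) refl = <⇒≱ l<l+r (proj₂ (proj₂ (cells-bounds l d∈)))
  absurd (right d∈) eq = <⇒≢ (+-mono-≤ (0<mins-node a b) (proj₁ (cells-bounds r d∈))) (sym (cong proj₁ eq))

-- Boxes of `l` have row at most column, hence at most `mins l`, while shifted boxes have a larger
-- row. The top box is listed only if `top-cell⇒corner` excludes it from `cells l`.
cells-unique : ∀ t → Unique (cells t)
cells-unique leaf = []
cells-unique (node l r) with cells-unique l | cells-unique r
cells-unique (node leaf r) | _ | ihʳ = Uniqueₚ.map⁺ (shift-injective 1) ihʳ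
cells-unique (node l@(node a b) r) | ihˡ | ihʳ =
  Uniqueₚ.++⁺ (top-unique (corner l)) rest (λ (p , q) → disjoint (corner l) refl p q)
  where
  rest : Unique (cells l ++ map (shift (mins l)) (cells r))
  rest = Uniqueₚ.++⁺ ihˡ (Uniqueₚ.map⁺ (shift-injective (mins l)) ihʳ) disj
    where
    disj : ∀ {c} → ¬ (c ∈ cells l × c ∈ map (shift (mins l)) (cells r))
    disj (p , q) with _ , d∈ , refl ← ∈-map⁻ (shift (mins l)) q =
      let (_ , i≤j , j≤) = cells-bounds l p in
      <⇒≱ (m<m+n (mins l) (proj₁ (cells-bounds r d∈))) (≤-trans i≤j j≤)
  top-unique : ∀ x → Unique (if x then [] else (1 , mins l) ∷ [])
  top-unique true  = []
  top-unique false = [] ∷ []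
  disjoint : ∀ x → corner l ≡ x → ∀ {c} → c ∈ (if x then [] else (1 , mins l) ∷ []) →
             ¬ c ∈ cells l ++ map (shift (mins l)) (cells r)
  disjoint false eq (here refl) q with ∈-++⁻ (cells l) q
  ... | inj₁ q′ with () ← trans (sym eq) (top-cell⇒corner l q′)
  ... | inj₂ q′ with (i , j) , d∈ , e ← ∈-map⁻ (shift (mins l)) q′ =
    <⇒≢ (+-mono-≤ (0<mins-node a b) (proj₁ (cells-bounds r d∈))) (cong proj₁ e)

-- The encoding seen from the entries: each non-minimum names its own box. Multiplicities are
-- forgotten, as only nonzero boxes count.
Occupied : List ℕ → ℕ × ℕ → Set
Occupied π c = ∃ λ p → p < length π × isMin π p ≡ false × c ≡ (suc (row π p) , col π p)

occupied⇒∈ : ∀ b t {c} → Occupied (perm b t) c → c ∈ cells t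
occupied⇒∈ b (node l r) occ with occupied⇒∈ (b + size r) l | occupied⇒∈ b r
occupied⇒∈ b (node leaf r) (p , p< , nonmin , refl) | _ | ihʳ with position 0 p
-- With σ empty the maximum is a minimum and lies in no box.
... | mid with () ← nonmin
... | right q = subst (_∈ cells (node leaf r))
        (cong₂ _,_ (trans (+-suc 1 _) (cong suc (sym (row-right q<)))) (sym (col-right {q})))
        (∈-map⁺ (shift 1) (ihʳ (q , q< , trans (sym (isMin-right q<)) nonmin , refl)))
  where
  open PermNode b leaf r
  q< = right<length⁻ p<
occupied⇒∈ b (node l@(node l₁ l₂) r) (p , p< , nonmin , refl) | ihˡ | ihʳ =
  ∈-cells-node⁺ l₁ l₂ r (cell p p< nonmin)
  where
  open PermNode b l r
  π = perm b (node l r)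
  front≡ : #front ≡ mins l
  front≡ = trans (#front-nonempty (nonempty-perm (b + size r) l₁ l₂)) (#mins-perm (b + size r) l)
  cell : ∀ p → p < length π → isMin π p ≡ false → NodeCell l r (suc (row π p) , col π p)
  cell p p< nonmin with position s p
  ... | left p<s = left (subst (_∈ cells l)
          (cong₂ (λ i j → suc i , j) (sym (row-left p<s)) (sym (col-left p<s)))
          (ihˡ (p , p<s , trans (sym (isMin-left p<s)) nonmin , refl)))
  ... | mid = subst (NodeCell l r)
          (cong₂ (λ i j → suc i , j) (sym row-mid) (sym (trans col-mid (#mins-perm (b + size r) l)))) top
  ... | right q = subst (NodeCell l r)
          (cong₂ _,_ (trans (+-suc (mins l) _) (cong suc (sym (trans (row-right q<) (cong (_+ row τ q) front≡)))))
                     (sym (trans (col-right {q}) (cong (_+ col τ q) front≡))))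
          (right (ihʳ (q , q< , trans (sym (isMin-right q<)) nonmin , refl)))
    where q< = right<length⁻ p<

∈⇒occupied : ∀ b t {c} → c ∈ cells t → Occupied (perm b t) c
∈⇒occupied b (node l r) c∈ with ∈⇒occupied (b + size r) l | ∈⇒occupied b r
∈⇒occupied b (node leaf r) c∈ | _ | ihʳ with _ , d∈ , refl ← ∈-map⁻ (shift 1) c∈
  with q , q< , nonmin , refl ← ihʳ d∈ =
  suc q , right<length q< , trans (isMin-right q<) nonmin ,
  cong₂ _,_ (cong suc (sym (row-right q<))) (sym (col-right {q}))
  where open PermNode b leaf r
∈⇒occupied b (node l@(node l₁ l₂) r) c∈ | ihˡ | ihʳ = occ (∈-cells-node⁻ l₁ l₂ r c∈)
  where
  open PermNode b l r
  0<s : 0 < s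
  0<s = nonempty-perm (b + size r) l₁ l₂
  front≡ : #front ≡ mins l
  front≡ = trans (#front-nonempty 0<s) (#mins-perm (b + size r) l)
  occ : ∀ {c} → NodeCell l r c → Occupied (perm b (node l r)) c
  occ top = s , mid<length , isMin-mid 0<s ,
    cong₂ (λ i j → suc i , j) (sym row-mid) (sym (trans col-mid (#mins-perm (b + size r) l)))
  occ (left d∈) with p , p<s , nonmin , refl ← ihˡ d∈ =
    p , left<length p<s , trans (isMin-left p<s) nonmin ,
    cong₂ (λ i j → suc i , j) (sym (row-left p<s)) (sym (col-left p<s))
  occ (right d∈) with q , q< , nonmin , refl ← ihʳ d∈ =
    suc s + q , right<length q< , trans (isMin-right q<) nonmin ,
    cong₂ _,_ (trans (+-suc (mins l) _) (cong suc (sym (trans (row-right q<) (cong (_+ row τ q) front≡)))))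
              (sym (trans (col-right {q}) (cong (_+ col τ q) front≡)))

-- The staircase encoding

at-∈ : ∀ xs {i} → i < length xs → at xs i ∈ xs
at-∈ (x ∷ xs) {zero} _ = here refl
at-∈ (x ∷ xs) {suc i} i< = there (at-∈ xs (s<s⁻¹ i<))

∈-at : ∀ {xs x} → x ∈ xs → ∃ λ i → i < length xs × at xs i ≡ x
∈-at (here refl) = 0 , z<s , refl
∈-at (there x∈) = let (i , i< , eq) = ∈-at x∈ in suc i , s<s i< , eq

at-injective : ∀ {xs} → Unique xs → ∀ {i j} → i < length xs → j < length xs →
               at xs i ≡ at xs j → i ≡ j
at-injective (_ ∷ _) {zero} {zero} _ _ _ = refl
at-injective {x ∷ xs} (x∉ ∷ _) {zero} {suc j} _ j< eq = ⊥-elim (All.lookup x∉ (at-∈ xs (s<s⁻¹ j<)) eq)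
at-injective {x ∷ xs} (x∉ ∷ _) {suc i} {zero} i< _ eq = ⊥-elim (All.lookup x∉ (at-∈ xs (s<s⁻¹ i<)) (sym eq))
at-injective (_ ∷ u) {suc i} {suc j} i< j< eq = cong suc (at-injective u (s<s⁻¹ i<) (s<s⁻¹ j<) eq)

-- The hypothesis makes `f` true exactly on an initial segment, whose length is the number of hits.
at-initial-segment : (f : ℕ → Bool) (xs : List ℕ) →
  AllPairs (λ x y → f y ≡ true → f x ≡ true) xs →
  ∀ {i} → i < length xs → f (at xs i) ≡ (i <ᵇ length (filterᵇ f xs))
at-initial-segment f (x ∷ xs) (px ∷ pxs) {i} i< with f x in fx
at-initial-segment f (x ∷ xs) (px ∷ pxs) {zero} i< | true = fx
at-initial-segment f (x ∷ xs) (px ∷ pxs) {suc i} i< | true = at-initial-segment f xs pxs (s<s⁻¹ i<)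
at-initial-segment f (x ∷ xs) (px ∷ pxs) {i} i< | false
  rewrite filter-none (T? ∘ f) {xs} (All.map (λ g t → false≢true (g (to T-≡ t))) px) =
  none i i<
  where
  none : ∀ i → i < suc (length xs) → f (at (x ∷ xs) i) ≡ false
  none zero _ = fx
  none (suc i) i< with f (at xs i) in eq
  ... | false = refl
  ... | true = sym (All.lookup px (at-∈ xs (s<s⁻¹ i<)) eq)

allPairs-guarded : ∀ {A : Set} {P : A → Set} {R : A → A → Set} {xs} →
  AllPairs (λ x y → P y → R x y) xs → All P xs → AllPairs R xs
allPairs-guarded [] [] = []
allPairs-guarded (r ∷ rs) (_ ∷ ps) = All.zipWith (λ (f , p) → f p) (r , ps) ∷ allPairs-guarded rs ps

module Boxes (π : List ℕ) (unique : Unique π)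
             (bounded : ∀ {p} → p < length π → at π p ≤ length π) where

  K : List ℕ
  K = lrMinPositions π

  length-K : length K ≡ #mins π
  length-K = length-filter-applyUpTo (isMin π) id (length π)

  ∈K⁻ : ∀ {k} → k ∈ K → k < length π × isMin π k ≡ true
  ∈K⁻ k∈ = let (k∈′ , min) = ∈-filter⁻ (T? ∘ isMin π) k∈ in ∈-upTo⁻ k∈′ , to T-≡ min

  K-increasing : AllPairs _<_ K
  K-increasing = AllPairsₚ.filter⁺ (T? ∘ isMin π) (AllPairsₚ.applyUpTo⁺₁ id (length π) (λ i<j _ → i<j))

  K-decreasing : AllPairs (λ k k′ → at π k′ < at π k) K
  K-decreasing = allPairs-guarded
    (AllPairs.map (λ {k} {k′} k<k′ min → isMin-elim π k′ (to T-≡ min) k k<k′) K-increasing)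
    (Allₚ.all-filter (T? ∘ isMin π) (upTo (length π)))

  count-K : ∀ f → length (filterᵇ f K) ≡ count (λ k → isMin π k ∧ f k) (length π)
  count-K f = trans (cong length (filter-filter f (isMin π) (upTo (length π))))
    (length-filter-applyUpTo _ id (length π))

  -- Positions of minima increase, so those before `p` form an initial segment of `K`; in `row-spec`
  -- the same holds for the minima above π_p, as their values decrease. Comparisons with grid lines
  -- thus become comparisons with coordinates.
  col-spec : ∀ p {j} → j < length K → (at K j <ᵇ p) ≡ (j <ᵇ col π p)
  col-spec p {j} j< = trans
    (at-initial-segment (_<ᵇ p) K
      (AllPairs.map (λ {_} {y} x<y y<p → <ᵇ-true {n = p} (<-trans x<y (true-< {y} y<p))) K-increasing) j<)
    (cong (j <ᵇ_) (count-K (_<ᵇ p)))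

  row-spec : ∀ p {i} → i < length K → (at π p <ᵇ at π (at K i)) ≡ (i <ᵇ row π p)
  row-spec p {i} i< = trans
    (at-initial-segment (λ k → at π p <ᵇ at π k) K
      (AllPairs.map (λ y<x p<y → <ᵇ-true (<-trans (true-< {at π p} p<y) y<x)) K-decreasing) i<)
    (cong (i <ᵇ_) (count-K (λ k → at π p <ᵇ at π k)))

  col≤ : ∀ p → col π p ≤ length K
  col≤ p = subst (_≤ length K) (count-K (_<ᵇ p)) (length-filter (T? ∘ (_<ᵇ p)) K)

  kpos-min : ∀ {j} → j < length K → kpos π (suc j) ≡ at K j
  kpos-min j< rewrite <ᵇ-true j< = refl

  kpos-end : ∀ {j} → length K ≤ j → kpos π (suc j) ≡ length π
  kpos-end ≤j rewrite <ᵇ-false ≤j = refl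

  InBox : ℕ → ℕ → ℕ → Set
  InBox i j p = kpos π j < p × p < kpos π (suc j) × kval π i < at π p × at π p < kval π (i ∸ 1)

  box≢0⇒ : ∀ i j → box π i j ≢ 0 → ∃ λ p → p < length π × InBox i j p
  box≢0⇒ i j box≢0 with filterᵇ (λ p → (kpos π j <ᵇ p) ∧ (p <ᵇ kpos π (suc j))
       ∧ (kval π i <ᵇ at π p) ∧ (at π p <ᵇ kval π (i ∸ 1))) (upTo (length π)) in eq
  ... | [] = ⊥-elim (box≢0 refl)
  ... | p ∷ ps =
    let (p∈ , t) = ∈-filter⁻ (T? ∘ _) (subst (p ∈_) (sym eq) (here refl))
        (t₁ , t′) = to T-∧ t
        (t₂ , t″) = to T-∧ t′
        (t₃ , t₄) = to T-∧ t″
    in p , ∈-upTo⁻ p∈ , <ᵇ⇒< _ _ t₁ , <ᵇ⇒< _ _ t₂ , <ᵇ⇒< _ _ t₃ , <ᵇ⇒< _ _ t₄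

  ⇒box≢0 : ∀ i j {p} → p < length π → InBox i j p → box π i j ≢ 0
  ⇒box≢0 i j p< (t₁ , t₂ , t₃ , t₄) = ∈⇒nonempty (∈-filter⁺ (T? ∘ _) (∈-upTo⁺ p<)
    (from T-∧ (<⇒<ᵇ t₁ , from T-∧ (<⇒<ᵇ t₂ , from T-∧ (<⇒<ᵇ t₃ , <⇒<ᵇ t₄)))))
    where
    ∈⇒nonempty : ∀ {x : ℕ} {xs} → x ∈ xs → length xs ≢ 0
    ∈⇒nonempty (here _) ()
    ∈⇒nonempty (there _) ()

  inBox⇒occupied : ∀ {i j p} → i ≤ j → j < length K → p < length π →
                   InBox (suc i) (suc j) p → Occupied π (suc i , suc j)
  inBox⇒occupied {i} {j} {p} i≤j j< p< (kj<p , p<kj′ , vi<p , p<vi′) =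
    p , p< , nonmin , cong₂ (λ r c → suc r , c) (≤-antisym (≤row i i< p<vi′) row≤) (≤-antisym <col col≤′)
    where
    i< : i < length K
    i< = ≤-<-trans i≤j j<
    <col : j < col π p
    <col = true-< (trans (sym (col-spec p j<)) (<ᵇ-true (subst (_< p) (kpos-min j<) kj<p)))
    col≤′ : col π p ≤ suc j
    col≤′ with suc j <? length K
    ... | yes sj< = false-≥ (trans (sym (col-spec p sj<)) (<ᵇ-false (<⇒≤ (subst (p <_) (kpos-min sj<) p<kj′))))
    -- In the last column the right border is the end of π, and the number of minima bounds `col`
    -- instead.
    ... | no sj≮ = ≤-trans (col≤ p) (≮⇒≥ sj≮)
    row≤ : row π p ≤ i
    row≤ = false-≥ (trans (sym (row-spec p i<))
      (<ᵇ-false (<⇒≤ (subst (_< at π p) (cong (at π) (kpos-min i<)) vi<p))))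
    ≤row : ∀ i → i < length K → at π p < kval π i → i ≤ row π p
    -- The upper border of the top row is n + 1 and imposes nothing.
    ≤row zero _ _ = z≤n
    ≤row (suc i) i< p<v = true-< (trans (sym (row-spec p (<⇒≤ i<)))
      (<ᵇ-true (subst (at π p <_) (cong (at π) (kpos-min (<⇒≤ i<))) p<v)))
    -- A minimum after k_j would lie below row j, hence below row i.
    nonmin : isMin π p ≡ false
    nonmin with isMin π p in eq
    ... | false = refl
    ... | true = ⊥-elim (<⇒≱ (true-< {j} (trans (sym (row-spec p j<))
            (<ᵇ-true (isMin-elim π p eq (at K j) (subst (_< p) (kpos-min j<) kj<p)))))
            (≤-trans row≤ i≤j))

  -- For the right and lower borders the specs give weak inequalities only; they are strict because
  -- `p` is no minimum and the entries are distinct.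
  occupied⇒inBox : ∀ {i j} → i ≤ j → j < length K → Occupied π (suc i , suc j) →
                   ∃ λ p → p < length π × InBox (suc i) (suc j) p
  occupied⇒inBox {i} {j} i≤j j< (p , p< , nonmin , eq) = p , p< ,
    subst (_< p) (sym (kpos-min j<)) (true-< (trans (col-spec p j<) (<ᵇ-true (≤-reflexive col≡)))) ,
    before ,
    subst (_< at π p) (cong (at π) (sym (kpos-min i<)))
      (≤∧≢⇒< (false-≥ (trans (row-spec p i<) (<ᵇ-false (≤-reflexive (sym row≡)))))
             (λ e → min≢p i< (at-injective unique (proj₁ (∈K⁻ (at-∈ K i<))) p< e))) ,
    below i i< (≤-reflexive row≡)
    where
    i< : i < length K
    i< = ≤-<-trans i≤j j<
    row≡ : i ≡ row π p
    row≡ = suc-injective (cong proj₁ eq)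
    col≡ : suc j ≡ col π p
    col≡ = cong proj₂ eq
    min≢p : ∀ {k} → k < length K → at K k ≢ p
    min≢p k< refl with () ← trans (sym (proj₂ (∈K⁻ (at-∈ K k<)))) nonmin
    before : p < kpos π (suc (suc j))
    before with suc j <? length K
    ... | yes sj< = subst (p <_) (sym (kpos-min sj<)) (≤∧≢⇒<
            (false-≥ (trans (col-spec p sj<) (<ᵇ-false (≤-reflexive (sym col≡))))) (≢-sym (min≢p sj<)))
    ... | no sj≮ = subst (p <_) (sym (kpos-end (≮⇒≥ sj≮))) p<
    below : ∀ i → i < length K → i ≤ row π p → at π p < kval π i
    below zero _ _ = s≤s (bounded p<)
    below (suc i) i< i≤ = subst (at π p <_) (cong (at π) (sym (kpos-min (<⇒≤ i<))))
      (true-< (trans (row-spec p (<⇒≤ i<)) (<ᵇ-true i≤)))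

-- The staircase grid as a list without duplicates

boxIndex : ℕ → ℕ → List (ℕ × ℕ)
boxIndex i j = if suc i ≤ᵇ suc j then (suc i , suc j) ∷ [] else []

∈-boxIndex⁻ : ∀ i j {c} → c ∈ boxIndex i j → c ≡ (suc i , suc j) × i ≤ j
∈-boxIndex⁻ i j c∈ with suc i ≤ᵇ suc j in eq
∈-boxIndex⁻ i j (here refl) | true = refl , s≤s⁻¹ (≤ᵇ⇒≤ (suc i) (suc j) (from T-≡ eq))

∈-boxIndex⁺ : ∀ {i j} → i ≤ j → (suc i , suc j) ∈ boxIndex i j
∈-boxIndex⁺ i≤j rewrite to T-≡ (≤⇒≤ᵇ (s≤s i≤j)) = here refl

boxRow : ℕ → ℕ → List (ℕ × ℕ)
boxRow a i = concatMap (boxIndex i) (upTo a)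

∈-concatMap-upTo⁻ : ∀ {A : Set} (f : ℕ → List A) n {x} → x ∈ concatMap f (upTo n) →
                    ∃ λ i → i < n × x ∈ f i
∈-concatMap-upTo⁻ f n x∈ with ys , x∈ys , ys∈ ← ∈-concat⁻′ (map f (upTo n)) x∈
  with i , i∈ , refl ← ∈-map⁻ f ys∈ = i , ∈-upTo⁻ i∈ , x∈ys

∈-concatMap-upTo⁺ : ∀ {A : Set} (f : ℕ → List A) {n i x} → i < n → x ∈ f i → x ∈ concatMap f (upTo n)
∈-concatMap-upTo⁺ f i< x∈ = ∈-concat⁺′ x∈ (∈-map⁺ f (∈-upTo⁺ i<))

concatMap-upTo-unique : ∀ {A : Set} (f : ℕ → List A) n → (∀ i → Unique (f i)) →
  (∀ {i j x} → i ≢ j → x ∈ f i → ¬ x ∈ f j) → Unique (concatMap f (upTo n))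
concatMap-upTo-unique f n u disj = Uniqueₚ.concat⁺ (Allₚ.map⁺ (All.universal u (upTo n)))
  (AllPairsₚ.map⁺ (AllPairs.map (λ i≢j {_} pq → disj i≢j (proj₁ pq) (proj₂ pq)) (Uniqueₚ.upTo⁺ n)))

boxRow-fst : ∀ {a i c} → c ∈ boxRow a i → proj₁ c ≡ suc i
boxRow-fst {a} {i} c∈ with j , _ , c∈′ ← ∈-concatMap-upTo⁻ (boxIndex i) a c∈ =
  cong proj₁ (proj₁ (∈-boxIndex⁻ i j c∈′))

boxesOf-unique : ∀ a → Unique (boxesOf a)
boxesOf-unique a = concatMap-upTo-unique (boxRow a) a
  (λ i → concatMap-upTo-unique (boxIndex i) a (λ j → unique₁ i j)
    (λ {j} {j′} j≢j′ p q → j≢j′ (suc-injective (trans (sym (cong proj₂ (proj₁ (∈-boxIndex⁻ i j p))))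
      (cong proj₂ (proj₁ (∈-boxIndex⁻ i j′ q)))))))
  (λ {i} {i′} i≢i′ p q → i≢i′ (suc-injective (trans (sym (boxRow-fst {a} {i} p)) (boxRow-fst {a} {i′} q))))
  where
  unique₁ : ∀ i j → Unique (boxIndex i j)
  unique₁ i j with suc i ≤ᵇ suc j
  ... | true  = [] ∷ []
  ... | false = []

∈-boxesOf⁻ : ∀ a {c} → c ∈ boxesOf a → ∃ λ i → ∃ λ j → c ≡ (suc i , suc j) × i ≤ j × j < a
∈-boxesOf⁻ a c∈ with i , _ , c∈′ ← ∈-concatMap-upTo⁻ (boxRow a) a c∈
  with j , j< , c∈″ ← ∈-concatMap-upTo⁻ (boxIndex i) a c∈′ =
  let (eq , i≤j) = ∈-boxIndex⁻ i j c∈″ in i , j , eq , i≤j , j<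

∈-boxesOf⁺ : ∀ a {i j} → i ≤ j → j < a → (suc i , suc j) ∈ boxesOf a
∈-boxesOf⁺ a {i} i≤j j< = ∈-concatMap-upTo⁺ (boxRow a) (≤-<-trans i≤j j<)
  (∈-concatMap-upTo⁺ (boxIndex i) j< (∈-boxIndex⁺ i≤j))

unique-⇔-length : ∀ {A : Set} {xs ys : List A} → Unique xs → Unique ys →
                  (∀ {x} → x ∈ xs ⇔ x ∈ ys) → length xs ≡ length ys
unique-⇔-length u v e = Permₚ.↭-length (∼bag⇒↭ (unique∧set⇒bag u v e))

nonzero-intro : ∀ {n} → n ≢ 0 → T (not (n ≡ᵇ 0))
nonzero-intro {zero} n≢0 = n≢0 refl
nonzero-intro {suc n} _ = _

nonzero-elim : ∀ {n} → T (not (n ≡ᵇ 0)) → n ≢ 0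
nonzero-elim {suc n} _ ()

-- Both lists are free of duplicates and have the same members, so their lengths agree.
nonzeroBoxes-perm : ∀ t → Unique (perm 0 t) → nonzeroBoxes (perm 0 t) ≡ #boxes t
nonzeroBoxes-perm t unique = trans
  (unique-⇔-length
    (Uniqueₚ.filter⁺ (T? ∘ nonzero) (boxesOf-unique (numLRMin π))) (cells-unique t) (mk⇔ ⇒ ⇐))
  (length-cells t)
  where
  π : List ℕ
  π = perm 0 t
  open Boxes π unique (λ {p} p< → subst (at (perm 0 t) p ≤_) (sym (length-perm 0 t)) (proj₂ (perm-bounds 0 t p<)))
  nonzero : ℕ × ℕ → Bool
  nonzero b = not (box π (proj₁ b) (proj₂ b) ≡ᵇ 0)
  length-K≡ : length K ≡ mins t
  length-K≡ = trans length-K (#mins-perm 0 t)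
  ⇒ : ∀ {c} → c ∈ filterᵇ nonzero (boxesOf (numLRMin π)) → c ∈ cells t
  ⇒ c∈ with c∈′ , nz ← ∈-filter⁻ (T? ∘ nonzero) {xs = boxesOf (numLRMin π)} c∈
    with i , j , refl , i≤j , j< ← ∈-boxesOf⁻ (numLRMin π) c∈′
    with p , p< , inBox ← box≢0⇒ (suc i) (suc j) (nonzero-elim nz) =
    occupied⇒∈ 0 t (inBox⇒occupied i≤j j< p< inBox)
  ⇐ : ∀ {c} → c ∈ cells t → c ∈ filterᵇ nonzero (boxesOf (numLRMin π))
  ⇐ {zero , _} c∈ with () ← proj₁ (cells-bounds t c∈)
  ⇐ {suc i , zero} c∈ with () ← proj₁ (proj₂ (cells-bounds t c∈))
  ⇐ {suc i , suc j} c∈ with _ , s≤s i≤j , j< ← cells-bounds t c∈ =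
    let j<K = subst (j <_) (sym length-K≡) j<
        (p , p< , inBox) = occupied⇒inBox i≤j j<K (∈⇒occupied 0 t c∈)
    in ∈-filter⁺ (T? ∘ nonzero) (∈-boxesOf⁺ (numLRMin π) i≤j j<K)
         (nonzero-intro (⇒box≢0 (suc i) (suc j) p< inBox))

-- Trees and 132-avoiders

Avoids-left : ∀ σ m τ → Avoids132 (σ ++ m ∷ τ) → Avoids132 σ
Avoids-left σ m τ avoids (p , q , r , p<q , q<r , r< , p<r , r<q) =
  avoids (p , q , r , p<q , q<r , left<length r< ,
    subst₂ _<_ (sym (at-left (<-trans p<q (<-trans q<r r<)))) (sym (at-left r<)) p<r ,
    subst₂ _<_ (sym (at-left r<)) (sym (at-left (<-trans q<r r<))) r<q)
  where open Split σ τ m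

Avoids-right : ∀ σ m τ → Avoids132 (σ ++ m ∷ τ) → Avoids132 τ
Avoids-right σ m τ avoids (p , q , r , p<q , q<r , r< , p<r , r<q) =
  avoids (suc s + p , suc s + q , suc s + r , +-monoʳ-< (suc s) p<q , +-monoʳ-< (suc s) q<r ,
    right<length r< ,
    subst₂ _<_ (sym (at-right p)) (sym (at-right r)) p<r ,
    subst₂ _<_ (sym (at-right r)) (sym (at-right q)) r<q)
  where open Split σ τ m

-- The last entry of a 132 decides. In σ, it keeps the whole pattern there; it is not the maximum,
-- as a larger entry precedes it; in τ, it is below everything in front, so the first entry lies in
-- τ too.
perm-avoids : ∀ b t → Avoids132 (perm b t)
perm-avoids b (node l r) (i , j , k , i<j , j<k , k< , i<k , k<j) =
  go (position s k) (position s i) i<j j<k k< i<k k<j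
  where
  open PermNode b l r
  π = perm b (node l r)
  go : ∀ {i j k} → Position s k → Position s i → i < j → j < k → k < length π →
       at π i < at π k → at π k < at π j → ⊥
  go (left k<s) _ i<j j<k k< i<k k<j = perm-avoids (b + size r) l
    (_ , _ , _ , i<j , j<k , k<s ,
     subst₂ _<_ (at-left (<-trans i<j (<-trans j<k k<s))) (at-left k<s) i<k ,
     subst₂ _<_ (at-left k<s) (at-left (<-trans j<k k<s)) k<j)
  go mid _ i<j j<k k< i<k k<j = <-asym (subst₂ _<_ at-mid (at-left j<k) k<j) (σ<peak j<k)
  go (right q) (left i<s) i<j j<k k< i<k k<j =
    <-asym (subst₂ _<_ (at-left i<s) (at-right q) i<k) (τ<σ i<s (right<length⁻ k<))
  go (right q) mid i<j j<k k< i<k k<j =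
    <-asym (subst₂ _<_ at-mid (at-right q) i<k) (τ<peak (right<length⁻ k<))
  go {j = j} (right q) (right p) i<j j<k k< i<k k<j with position s j
  ... | left j<s = <⇒≱ i<j (≤-trans (<⇒≤ j<s) (m≤n⇒m≤1+n (m≤m+n s p)))
  ... | mid = <⇒≱ i<j (m≤n⇒m≤1+n (m≤m+n s p))
  ... | right o = perm-avoids b r
    (p , o , q , +-cancelˡ-< (suc s) p o i<j , +-cancelˡ-< (suc s) o q j<k , right<length⁻ k< ,
     subst₂ _<_ (at-right p) (at-right q) i<k , subst₂ _<_ (at-right q) (at-right o) k<j)

-- Every avoider comes from exactly one tree

range : ℕ → ℕ → List ℕ
range b n = applyUpTo (λ k → suc (b + k)) n

range-+ : ∀ b m n → range b (m + n) ≡ range b m ++ range (b + m) n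
range-+ b zero n rewrite +-identityʳ b = refl
range-+ b (suc m) n = cong (suc (b + 0) ∷_) (begin
  applyUpTo (λ k → suc (b + suc k)) (m + n)                           ≡⟨ shifted (m + n) ⟩
  range (suc b) (m + n)                                               ≡⟨ range-+ (suc b) m n ⟩
  range (suc b) m ++ range (suc b + m) n
    ≡⟨ cong₂ (λ xs c → xs ++ range c n) (sym (shifted m)) (sym (+-suc b m)) ⟩
  applyUpTo (λ k → suc (b + suc k)) m ++ range (b + suc m) n          ∎)
  where
  open ≡-Reasoning
  applyUpTo-cong : ∀ {f g : ℕ → ℕ} n → (∀ k → f k ≡ g k) → applyUpTo f n ≡ applyUpTo g n
  applyUpTo-cong zero eq = refl
  applyUpTo-cong (suc n) eq = cong₂ _∷_ (eq 0) (applyUpTo-cong n (eq ∘ suc))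
  shifted : ∀ k → applyUpTo (λ j → suc (b + suc j)) k ≡ range (suc b) k
  shifted k = applyUpTo-cong k (λ j → cong suc (+-suc b j))

perm-↭ : ∀ b t → perm b t ↭ range b (size t)
perm-↭ b leaf = Perm.refl
perm-↭ b (node l r) = begin
  perm (b + size r) l ++ suc (b + size r + size l) ∷ perm b r
    ↭⟨ Permₚ.shift (suc (b + size r + size l)) (perm (b + size r) l) (perm b r) ⟩
  suc (b + size r + size l) ∷ perm (b + size r) l ++ perm b r
    ↭⟨ Perm.prep _ (Permₚ.++⁺ (perm-↭ (b + size r) l) (perm-↭ b r)) ⟩
  suc (b + size r + size l) ∷ range (b + size r) (size l) ++ range b (size r)
    ↭⟨ Perm.prep _ (Permₚ.++-comm (range (b + size r) (size l)) (range b (size r))) ⟩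
  suc (b + size r + size l) ∷ range b (size r) ++ range (b + size r) (size l)
    ≡⟨ cong₂ _∷_ (cong suc (+-assoc b (size r) (size l))) (sym (range-+ b (size r) (size l))) ⟩
  suc (b + (size r + size l)) ∷ range b (size r + size l)
    ↭⟨ Permₚ.∷↭∷ʳ _ (range b (size r + size l)) ⟩
  range b (size r + size l) ∷ʳ suc (b + (size r + size l))
    ≡⟨ applyUpTo-∷ʳ (λ k → suc (b + k)) (size r + size l) ⟩
  range b (suc (size r + size l))
    ≡⟨ cong (range b) (trans (cong suc (+-comm (size r) (size l))) (sym (+-suc (size l) (size r)))) ⟩
  range b (size (node l r)) ∎
  where open Perm.PermutationReasoning

Unique-resp-↭ : ∀ {xs ys : List ℕ} → xs ↭ ys → Unique xs → Unique ys
Unique-resp-↭ p = PermSetoidₚ.Unique-resp-↭ (setoid ℕ) (↭⇒↭ₛ p)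

range-unique : ∀ b n → Unique (range b n)
range-unique b n = Uniqueₚ.applyUpTo⁺₁ _ n (λ i<j _ eq → <⇒≢ i<j (+-cancelˡ-≡ b _ _ (suc-injective eq)))

range-sorted : ∀ b n → AllPairs _≤_ (range b n)
range-sorted b n = AllPairsₚ.applyUpTo⁺₁ _ n (λ i<j _ → s≤s (+-monoʳ-≤ b (<⇒≤ i<j)))

∈-range⁻ : ∀ b n {x} → x ∈ range b n → x ≤ b + n
∈-range⁻ b n x∈ with i , i< , refl ← ∈-applyUpTo⁻ (λ k → suc (b + k)) x∈ =
  subst (_≤ b + n) (+-suc b i) (+-monoʳ-≤ b i<)

sorted-↭⇒≡ : ∀ {xs ys : List ℕ} → AllPairs _≤_ xs → AllPairs _≤_ ys → xs ↭ ys → xs ≡ ys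
sorted-↭⇒≡ xs↗ ys↗ p = Pointwise-≡⇒≡ (↗↭↗⇒≋ ≤-totalOrder
  (AllPairs⇒Sorted ≤-totalOrder xs↗) (AllPairs⇒Sorted ≤-totalOrder ys↗) (↭⇒↭ₛ p))

++-injective : ∀ {A : Set} (xs ys : List A) {us vs} → length xs ≡ length ys →
               xs ++ us ≡ ys ++ vs → xs ≡ ys × us ≡ vs
++-injective [] [] _ eq = refl , eq
++-injective (x ∷ xs) (y ∷ ys) len eq with refl , eq′ ← ∷-injective eq
  with refl , eq″ ← ++-injective xs ys (suc-injective len) eq′ = refl , eq″

-- The two sorted parts concatenate to a sorted list, which must be the range itself, and the range
-- splits by length.
split-range : ∀ b n (τ σ : List ℕ) → τ ++ σ ↭ range b n →
  (∀ {x y} → x ∈ τ → y ∈ σ → x ≤ y) →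
  τ ↭ range b (length τ) × σ ↭ range (b + length τ) (length σ)
split-range b n τ σ p τ≤σ =
  ↭-trans (↭-sym (sort-↭ τ)) (↭-reflexive (proj₁ split)) ,
  ↭-trans (↭-sym (sort-↭ σ)) (↭-reflexive (proj₂ split))
  where
  sorted : AllPairs _≤_ (sort τ ++ sort σ)
  sorted = AllPairsₚ.++⁺ (Sorted⇒AllPairs ≤-totalOrder (sort-↗ τ)) (Sorted⇒AllPairs ≤-totalOrder (sort-↗ σ))
    (All.tabulate λ x∈ → All.tabulate λ y∈ →
      τ≤σ (Permₚ.∈-resp-↭ (sort-↭ τ) x∈) (Permₚ.∈-resp-↭ (sort-↭ σ) y∈))
  n≡ : n ≡ length τ + length σ
  n≡ = trans (sym (length-applyUpTo _ n)) (trans (sym (Permₚ.↭-length p)) (length-++ τ))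
  split : sort τ ≡ range b (length τ) × sort σ ≡ range (b + length τ) (length σ)
  split = ++-injective (sort τ) (range b (length τ))
    (trans (Permₚ.↭-length (sort-↭ τ)) (sym (length-applyUpTo _ (length τ))))
    (trans (sorted-↭⇒≡ sorted (range-sorted b n) (↭-trans (Permₚ.++⁺ (sort-↭ τ) (sort-↭ σ)) p))
      (trans (cong (range b) n≡) (range-+ b (length τ) (length σ))))

-- If x < y, then x m y is a 132.
after<before : ∀ σ m τ → Avoids132 (σ ++ m ∷ τ) → Unique (σ ++ m ∷ τ) → (∀ {y} → y ∈ τ → y < m) →
               ∀ {x y} → y ∈ τ → x ∈ σ → y ≤ x
after<before σ m τ avoids unique τ<m {x} {y} y∈ x∈ with y ≤? x
... | yes y≤x = y≤x
... | no y≰x with p , p< , refl ← ∈-at x∈ | q , q< , refl ← ∈-at y∈ =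
  ⊥-elim (avoids (p , s , suc s + q , p< , s≤s (m≤m+n s q) , right<length q< ,
    subst₂ _<_ (sym (at-left p<)) (sym (at-right q)) (≰⇒> y≰x) ,
    subst₂ _<_ (sym (at-right q)) (sym at-mid) (τ<m y∈)))
  where open Split σ τ m

-- `fuel` carries the recursion: σ and τ are shorter than π, but not subterms of it.
perm-surjective : ∀ fuel b n π → n ≤ fuel → π ↭ range b n → Avoids132 π →
                  ∃ λ t → size t ≡ n × perm b t ≡ π
perm-surjective fuel b zero π _ p _ with refl ← Permₚ.↭-empty-inv p = leaf , refl , refl
perm-surjective (suc fuel) b (suc k) π (s≤s k≤fuel) p avoids
  -- The last value of the range is the maximum, where π is cut.
  with σ , τ , refl ← ∈-∃++ (
         Permₚ.∈-resp-↭ (↭-sym p) (∈-applyUpTo⁺ (λ k → suc (b + k)) {k} {suc k} ≤-refl)) =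
  node l r , size≡ , perm≡
  where
  m = suc (b + k)
  rest : σ ++ τ ↭ range b k
  rest = ↭-trans
    (Permₚ.drop-mid σ (range b k) (↭-trans p (↭-reflexive (sym (applyUpTo-∷ʳ (λ k → suc (b + k)) k)))))
    (↭-reflexive (++-identityʳ (range b k)))
  τ<m : ∀ {y} → y ∈ τ → y < m
  τ<m y∈ = s≤s (∈-range⁻ b k (Permₚ.∈-resp-↭ rest (∈-++⁺ʳ σ y∈)))
  k≡ : k ≡ length σ + length τ
  k≡ = trans (sym (length-applyUpTo _ k)) (trans (sym (Permₚ.↭-length rest)) (length-++ σ))
  parts = split-range b k τ σ (↭-trans (Permₚ.++-comm τ σ) rest)
    (after<before σ m τ avoids (Unique-resp-↭ (↭-sym p) (range-unique b (suc k))) τ<m)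
  ihʳ = perm-surjective fuel b (length τ) τ
    (≤-trans (subst (length τ ≤_) (sym k≡) (m≤n+m _ (length σ))) k≤fuel)
    (proj₁ parts) (Avoids-right σ m τ avoids)
  ihˡ = perm-surjective fuel (b + length τ) (length σ) σ
    (≤-trans (subst (length σ ≤_) (sym k≡) (m≤m+n _ (length τ))) k≤fuel)
    (proj₂ parts) (Avoids-left σ m τ avoids)
  l r : Tree
  l = proj₁ ihˡ
  r = proj₁ ihʳ
  size≡ : size l + suc (size r) ≡ suc k
  size≡ = trans (cong₂ (λ x y → x + suc y) (proj₁ (proj₂ ihˡ)) (proj₁ (proj₂ ihʳ)))
    (trans (+-suc (length σ) (length τ)) (cong suc (sym k≡)))
  perm≡ : perm b (node l r) ≡ σ ++ m ∷ τ
  perm≡ = cong₂ _++_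
    (trans (cong (λ c → perm (b + c) l) (proj₁ (proj₂ ihʳ))) (proj₂ (proj₂ ihˡ)))
    (cong₂ _∷_
      (cong suc (trans (+-assoc b (size r) (size l)) (cong (b +_)
        (suc-injective (trans (cong suc (+-comm (size r) (size l))) (trans (sym (+-suc (size l) (size r))) size≡))))))
      (proj₂ (proj₂ ihʳ)))

split-at-injective : ∀ {A : Set} {x : A} xs ys {us vs} → ¬ x ∈ xs → ¬ x ∈ ys →
                     xs ++ x ∷ us ≡ ys ++ x ∷ vs → xs ≡ ys × us ≡ vs
split-at-injective [] [] _ _ refl = refl , refl
split-at-injective [] (y ∷ ys) _ x∉ eq = ⊥-elim (x∉ (here (proj₁ (∷-injective eq))))
split-at-injective (x ∷ xs) [] x∉ _ eq = ⊥-elim (x∉ (here (sym (proj₁ (∷-injective eq)))))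
split-at-injective (x ∷ xs) (y ∷ ys) x∉ y∉ eq with refl , eq′ ← ∷-injective eq
  with refl , eq″ ← split-at-injective xs ys (x∉ ∘ there) (y∉ ∘ there) eq′ = refl , eq″

-- Equal lengths give equal maxima, and a maximum absent from both left parts marks the same cut.
perm-injective : ∀ b t t′ → perm b t ≡ perm b t′ → t ≡ t′
perm-injective b leaf leaf _ = refl
perm-injective b leaf (node l r) eq with () ← trans (cong length eq)
  (trans (length-perm b (node l r)) (+-suc (size l) (size r)))
perm-injective b (node l r) leaf eq with () ← trans (sym (cong length eq))
  (trans (length-perm b (node l r)) (+-suc (size l) (size r)))
perm-injective b (node l r) (node l′ r′) eq = cong₂ node l≡ r≡
  where
  open PermNode b
  peak≡ : peak l r ≡ peak l′ r′
  peak≡ = cong suc (trans (+-assoc b _ _) (trans (cong (b +_)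
    (suc-injective (trans (sum l r) (trans (sym (length-perm b (node l r)))
      (trans (cong length eq) (trans (length-perm b (node l′ r′)) (sym (sum l′ r′))))))))
    (sym (+-assoc b _ _))))
    where
    sum : ∀ l r → suc (size r + size l) ≡ size (node l r)
    sum l r = trans (cong suc (+-comm (size r) (size l))) (sym (+-suc (size l) (size r)))
  peak∉ : ∀ l r → ¬ peak l r ∈ σ l r
  peak∉ l r x∈ with p , p< , e ← ∈-at x∈ = <⇒≢ (σ<peak l r p<) e
  halves : σ l r ≡ σ l′ r′ × τ l r ≡ τ l′ r′
  halves = split-at-injective (σ l r) (σ l′ r′) (peak∉ l r) (peak∉ l′ r′ ∘ subst (_∈ σ l′ r′) peak≡)
    (trans eq (cong (λ x → σ l′ r′ ++ x ∷ τ l′ r′) (sym peak≡)))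
  r≡ : r ≡ r′
  r≡ = perm-injective b r r′ (proj₂ halves)
  -- The offset of the left part depends on the right subtree, which is therefore identified first.
  l≡ : l ≡ l′
  l≡ = perm-injective (b + size r) l l′
    (trans (proj₁ halves) (cong (λ c → perm (b + size c) l′) (sym r≡)))

range-0 : ∀ n → map suc (upTo n) ≡ range 0 n
range-0 n = map-upTo suc n

perm-unique : ∀ t → Unique (perm 0 t)
perm-unique t = Unique-resp-↭ (↭-sym (perm-↭ 0 t)) (range-unique 0 (size t))

JTree⇒JProp : ∀ i t → JTree i t → JProp (3 * i + 1) (2 * i) (perm 0 t)
JTree⇒JProp i t (size≡ , boxes≡) =
  ↭-trans (perm-↭ 0 t) (↭-reflexive (trans (cong (range 0) size≡) (sym (range-0 (3 * i + 1))))) ,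
  perm-avoids 0 t ,
  trans (nonzeroBoxes-perm t (perm-unique t)) boxes≡

JProp⇒JTree : ∀ i π → JProp (3 * i + 1) (2 * i) π → ∃ λ t → JTree i t × π ≡ perm 0 t
JProp⇒JTree i π (isPerm , avoids , boxes≡)
  with t , size≡ , refl ← perm-surjective _ 0 (3 * i + 1) π ≤-refl
         (↭-trans isPerm (↭-reflexive (range-0 (3 * i + 1)))) avoids =
  t , (size≡ , trans (sym (nonzeroBoxes-perm t (perm-unique t))) boxes≡) , refl

theorem2p9 : (i : ℕ) → 1 ≤ i →
    Σ ℕ λ m → JIs (3 * i + 1) (2 * i) m × 0 < m × 2 * m ≡ 3 * ((2 * i) C i)
theorem2p9 i 1≤i = #N 1 i + #M 0 i ,
  counted-⇔ (λ { _ (t , j , refl) → JTree⇒JProp i t j }) (JProp⇒JTree i)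
    (counted-map (perm 0) (perm-injective 0 _ _) (counted-JTree i)) ,
  ≤-trans (#N-pos 0 i) (m≤m+n (#N 1 i) (#M 0 i)) ,
  count-closed i 1≤i
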